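{- For any integer $\ell\ge1$ and any constant $0<c<\frac{1}{3\ell}$, we have, as $n\to\infty$, \[g(n;2\ell+1,cn)\ge\left(\frac{\ell-1}{\ell}+c+o(1)\right)\frac{n^2}{2}.\]
   Context: A red/blue/purple colouring of $K_n$ is a partition $R\cup B\cup P$ of its edge set. For integers $s,t\ge2$ and $n<R(s,t)$, $g(n;s,t)$ is the largest integer $g$ such that some red/blue/purple colouring of $K_n$ has $|P|=g$, $R\cup P$ is $K_s$-free and $B\cup P$ is $K_t$-free; for non-integer arguments $g(n;s,t):=g(n;\lceil s\rceil,\lceil t\rceil)$.
   Formalization: The constant c is taken to be rational instead of real; the case of real c follows by approximating c from below by rationals, since g(n;s,t) is monotone in t. -}

module Defs where

open import Data.Nat using (ℕ; _<ᵇ_)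
open import Data.Fin using (Fin; toℕ)
open import Data.List using (List; map; allFin)
open import Data.Nat.ListAction using (sum)
open import Data.Bool using (Bool; true; false; _∧_; if_then_else_)
open import Data.Product using (Σ; _×_)
open import Relation.Binary.PropositionalEquality using (_≡_; _≢_)
open import Relation.Nullary using (¬_)
open import Function.Definitions using (Injective)

data Colour : Set where
  red blue purple : Colour

isPurple : Colour → Bool
isPurple purple = true
isPurple _      = false

-- A red/blue/purple colouring of K_n: a colour for every (unordered) pair,
-- given as a symmetric function on ordered pairs; values on the diagonal are ignored.
Colouring : ℕ → Set
Colouring n = Fin n → Fin n → Colour

IsSymmetric : {n : ℕ} → Colouring n → Set
IsSymmetric {n} col = (i j : Fin n) → col i j ≡ col j i

purpleCount : {n : ℕ} → Colouring n → ℕ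
purpleCount {n} col =
  sum (map (λ i → sum (map (λ j →
    if (toℕ i <ᵇ toℕ j) ∧ isPurple (col i j) then 1 else 0) (allFin n))) (allFin n))

ContainsK : {n : ℕ} → (s : ℕ) → (Fin n → Fin n → Set) → Set
ContainsK {n} s E = Σ (Fin s → Fin n) λ f → Injective _≡_ _≡_ f × ((a b : Fin s) → a ≢ b → E (f a) (f b))

KFree : {n : ℕ} → (s : ℕ) → (Fin n → Fin n → Set) → Set
KFree s E = ¬ ContainsK s E

RedOrPurple : {n : ℕ} → Colouring n → Fin n → Fin n → Set
RedOrPurple col i j = col i j ≢ blue

BlueOrPurple : {n : ℕ} → Colouring n → Fin n → Fin n → Set
BlueOrPurple col i j = col i j ≢ red

{-# OPTIONS --safe #-}

-- A clique of B ∪ P is an independent set of R, so R must be sparse with all independent sets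
-- smaller than cn.  Split the vertices into ℓ parts, place the vertices of each part on a
-- discrete circle and join by purple all pairs in different parts and all nearly antipodal
-- pairs (an arc of relative length cℓ < 1/3) of the same part.  Two vertices of a part with a
-- common purple neighbour are then at distance less than the length of the arc.  Red is a sparse,
-- random-like graph on the pairs in different parts or at larger distance: a red edge never closes two purple
-- ones to a triangle, and the few purple edges that would close two red ones are dropped.
-- Hence every part is (R ∪ P)-triangle-free and R ∪ P has no clique on 2ℓ + 1 vertices.
-- Since red meets every pair of large subsets of two far clusters, an independent set of R lives,
-- up to a small error, on pairwise close positions of one part; as the arc is shorter than a
-- third of the circle, these fill no more than an arc, that is cn vertices.
-- The red graph is found greedily on a fixed finite set of labels: some edge that closes no
-- triangle and respects a degree bound hits a constant proportion of the pairs of large sets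
-- not yet hit.  One finite colouring is then blown up to all large n.

module Submission where

module Colourings where

  open import Defs
  open import Data.Nat
  open import Data.Nat.Properties
  open import Data.Nat.DivMod
  open import Data.Nat.ListAction using () renaming (sum to sumᴸ)
  open import Data.Nat.Tactic.RingSolver using (solve-∀)
  open import Data.Fin using (Fin; zero; suc; toℕ; fromℕ<; combine; remQuot; punchIn; _↑ˡ_; _↑ʳ_) renaming (_≟_ to _≟F_)
  open import Data.Fin.Patterns using (0F; 1F; 2F)
  import Data.Fin.Properties as Fin
  open import Data.Bool using (Bool; true; false; _∧_; _∨_; if_then_else_)
  open import Data.Bool.Properties using (∨-comm; ∧-comm; T-≡)
  open import Data.Empty using (⊥; ⊥-elim)
  open import Data.List as List using (List; []; _∷_; allFin; length; cartesianProduct; filter)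
  import Data.List.Properties as List
  open import Data.List.Membership.Propositional using (_∈_)
  open import Data.List.Membership.Propositional.Properties using (∈-map⁺; ∈-++⁺ˡ; ∈-++⁺ʳ; ∈-cartesianProduct⁺; ∈-filter⁺)
  open import Data.List.Relation.Unary.Any using (here; there)
  open import Data.List.Relation.Unary.All using (All; []; _∷_)
  open import Data.List.Relation.Unary.All.Properties using (all-filter)
  open import Data.Vec as Vec using (Vec; []; _∷_; lookup)
  open import Data.Vec.Functional using (removeAt)
  open import Data.Vec.Properties using (lookup∘tabulate)
  open import Data.Product
  open import Data.Sum using (_⊎_; inj₁; inj₂)
  open import Relation.Nullary
  open import Relation.Nullary.Decidable using (dec-true; dec-false; _×-dec_; _⊎-dec_; ¬?; does-⇔; decidable-stable)
  open import Relation.Binary.PropositionalEquality hiding (J)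
  open import Relation.Binary.Definitions using (tri<; tri≈; tri>)
  open import Function using (_∘_; id; mk⇔; Equivalence)
  open import Function.Definitions using (Injective)
  open import Algebra.Properties.Semiring.Sum +-*-semiring using (sum; sum-cong-≗; sum-remove; ∑-distrib-+; ∑-comm; *-distribˡ-sum; *-distribʳ-sum)

  -- Finite sums

  𝟙 : Bool → ℕ
  𝟙 b = if b then 1 else 0

  𝟙≤1 : ∀ b → 𝟙 b ≤ 1
  𝟙≤1 true  = ≤-refl
  𝟙≤1 false = z≤n

  sum-mono-≤ : ∀ {n} {f g : Fin n → ℕ} → (∀ i → f i ≤ g i) → sum f ≤ sum g
  sum-mono-≤ {zero}  f≤g = z≤n
  sum-mono-≤ {suc n} f≤g = +-mono-≤ (f≤g zero) (sum-mono-≤ (f≤g ∘ suc))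

  sum-const : ∀ n c → sum {n} (λ _ → c) ≡ n * c
  sum-const zero    c = refl
  sum-const (suc n) c = cong (c +_) (sum-const n c)

  term≤sum : ∀ {n} (f : Fin n → ℕ) i → f i ≤ sum f
  term≤sum f zero    = m≤m+n _ _
  term≤sum f (suc i) = ≤-trans (term≤sum (f ∘ suc) i) (m≤n+m _ _)

  -- The least member of a pairwise near set on the circle is the origin from which the others are
  -- measured.
  least-positive-term : ∀ {n} (f : Fin n → ℕ) → 1 ≤ sum f → ∃ λ i → 1 ≤ f i × (∀ j → 1 ≤ f j → toℕ i ≤ toℕ j)
  least-positive-term {suc n} f 1≤Σ with f zero in eq
  ... | suc _ = zero , subst (1 ≤_) (sym eq) (s≤s z≤n) , λ _ _ → z≤n
  ... | zero with i , 1≤fi , least ← least-positive-term (f ∘ suc) 1≤Σ = suc i , 1≤fi , least′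
    where
    least′ : ∀ j → 1 ≤ f j → suc (toℕ i) ≤ toℕ j
    least′ zero    1≤f₀ = contradiction (subst (1 ≤_) eq 1≤f₀) λ ()
    least′ (suc j) 1≤fj = s≤s (least j 1≤fj)

  positive-term : ∀ {n} (f : Fin n → ℕ) → 1 ≤ sum f → ∃ λ i → 1 ≤ f i
  positive-term f 1≤Σ with i , 1≤fi , _ ← least-positive-term f 1≤Σ = i , 1≤fi

  average-≤-term : ∀ {n} .{{_ : NonZero n}} (f : Fin n → ℕ) c → n * c ≤ sum f → ∃ λ i → c ≤ f i
  average-≤-term {suc n} = go n
    where
    go : ∀ n (f : Fin (suc n) → ℕ) c → suc n * c ≤ sum f → ∃ λ i → c ≤ f i
    go zero    f c le = zero , subst₂ _≤_ (+-identityʳ c) (+-identityʳ (f zero)) le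
    go (suc n) f c le with c ≤? f zero
    ... | yes c≤f₀ = zero , c≤f₀
    ... | no  c≰f₀ = map suc id (go n (f ∘ suc) c
      (+-cancelˡ-≤ c _ _ (≤-trans le (+-monoˡ-≤ _ (<⇒≤ (≰⇒> c≰f₀))))))

  sum≤single : ∀ {n} (f : Fin n → ℕ) B → (∀ i → f i ≤ B) → (∀ i j → 1 ≤ f i → 1 ≤ f j → i ≡ j) → sum f ≤ B
  sum≤single {zero}  f B f≤B uniq = z≤n
  sum≤single {suc n} f B f≤B uniq with f zero in eq
  ... | zero  = sum≤single (f ∘ suc) B (f≤B ∘ suc) (λ i j p q → Fin.suc-injective (uniq (suc i) (suc j) p q))
  ... | suc a = ≤-trans (≤-reflexive (trans (cong (suc a +_) rest≡0) (trans (+-identityʳ _) (sym eq)))) (f≤B zero)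
    where
    rest≡0 : sum (f ∘ suc) ≡ 0
    rest≡0 with sum (f ∘ suc) in eq′
    ... | zero  = refl
    ... | suc _ with positive-term (f ∘ suc) (subst (1 ≤_) (sym eq′) (s≤s z≤n))
    ...   | i , 1≤fi with uniq zero (suc i) (subst (1 ≤_) (sym eq) (s≤s z≤n)) 1≤fi
    ...     | ()

  δ : ∀ {n} → Fin n → Fin n → ℕ
  δ i j = 𝟙 (does (i ≟F j))

  δ-refl : ∀ {n} (i : Fin n) → δ i i ≡ 1
  δ-refl i = cong 𝟙 (dec-true (i ≟F i) refl)

  δ≥1⇒≡ : ∀ {n} {i j : Fin n} → 1 ≤ δ i j → i ≡ j
  δ≥1⇒≡ {i = i} {j} le with i ≟F j
  ... | yes p = p

  -- Each `f i` is placed at the index `φ i` and the double sum is swapped; every fibre then has at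
  -- most one nonzero term. Injectivity is asked only on the support of `f`, so `φ` may be arbitrary
  -- elsewhere.
  sum-transport-≤ : ∀ {m n} (f : Fin m → ℕ) (g : Fin n → ℕ) (φ : Fin m → Fin n) →
    (∀ i → f i ≤ g (φ i)) → (∀ i j → 1 ≤ f i → 1 ≤ f j → φ i ≡ φ j → i ≡ j) → sum f ≤ sum g
  sum-transport-≤ {m} {n} f g φ f≤g inj = begin
    sum f                                  ≤⟨ sum-mono-≤ (λ i → ≤-trans (≤-reflexive (sym (trans (cong (_* f i) (δ-refl (φ i))) (*-identityˡ _)))) (term≤sum (λ j → δ (φ i) j * f i) (φ i))) ⟩
    sum (λ i → sum (λ j → δ (φ i) j * f i)) ≡⟨ ∑-comm (λ i j → δ (φ i) j * f i) ⟩
    sum (λ j → sum (λ i → δ (φ i) j * f i)) ≤⟨ sum-mono-≤ (λ j → sum≤single _ (g j) (bound j) (unique j)) ⟩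
    sum g ∎
    where
    open ≤-Reasoning
    bound : ∀ j i → δ (φ i) j * f i ≤ g j
    bound j i with φ i ≟F j
    ... | yes refl = subst (_≤ g (φ i)) (sym (*-identityˡ (f i))) (f≤g i)
    ... | no _     = z≤n
    split : ∀ j i → 1 ≤ δ (φ i) j * f i → φ i ≡ j × 1 ≤ f i
    split j i le with φ i ≟F j
    ... | yes p = p , subst (1 ≤_) (*-identityˡ (f i)) le
    unique : ∀ j i i′ → 1 ≤ δ (φ i) j * f i → 1 ≤ δ (φ i′) j * f i′ → i ≡ i′
    unique j i i′ p q with split j i p | split j i′ q
    ... | e , p′ | e′ , q′ = inj i i′ p′ q′ (trans e (sym e′))

  sum-↑ : ∀ m n (f : Fin (m + n) → ℕ) → sum f ≡ sum (f ∘ (_↑ˡ n)) + sum (f ∘ (m ↑ʳ_))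
  sum-↑ zero    n f = refl
  sum-↑ (suc m) n f = trans (cong (f zero +_) (sum-↑ m n (f ∘ suc))) (sym (+-assoc (f zero) _ _))

  sum-combine : ∀ m n (f : Fin (m * n) → ℕ) → sum f ≡ sum (λ i → sum (λ j → f (combine {m} {n} i j)))
  sum-combine zero    n f = refl
  sum-combine (suc m) n f = trans (sum-↑ n (m * n) f) (cong (sum (f ∘ (_↑ˡ (m * n))) +_) (sum-combine m n (f ∘ (n ↑ʳ_))))

  sum-allFin : ∀ {n} (f : Fin n → ℕ) → sumᴸ (List.map f (allFin n)) ≡ sum f
  sum-allFin f = trans (cong sumᴸ (List.map-tabulate id f)) (tab f)
    where
    tab : ∀ {n} (f : Fin n → ℕ) → sumᴸ (List.tabulate f) ≡ sum f
    tab {zero}  f = refl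
    tab {suc n} f = cong (f zero +_) (tab (f ∘ suc))

  sumℕ : ℕ → (ℕ → ℕ) → ℕ
  sumℕ n f = sum {n} (f ∘ toℕ)

  sumℕ-+ : ∀ m n f → sumℕ (m + n) f ≡ sumℕ m f + sumℕ n (λ i → f (m + i))
  sumℕ-+ zero    n f = refl
  sumℕ-+ (suc m) n f = trans (cong (f 0 +_) (sumℕ-+ m n (f ∘ suc))) (sym (+-assoc (f 0) _ _))

  module _ (K : ℕ) .{{_ : NonZero K}} (g : Fin K → ℕ) where

    private
      G : ℕ → ℕ
      G i = g (i mod K)

      mod-+ : ∀ i → (K + i) mod K ≡ i mod K
      mod-+ i = Fin.toℕ-injective (trans (Fin.toℕ-fromℕ< _) (trans (trans (cong (_% K) (+-comm K i)) ([m+n]%n≡m%n i K)) (sym (Fin.toℕ-fromℕ< _))))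

      toℕ-mod : ∀ (i : Fin K) → toℕ i mod K ≡ i
      toℕ-mod i = Fin.toℕ-injective (trans (Fin.toℕ-fromℕ< _) (m<n⇒m%n≡m (Fin.toℕ<n i)))

      period : sumℕ K G ≡ sum g
      period = sum-cong-≗ (λ i → cong g (toℕ-mod i))

    -- In the blow-up, vertex i lies in class i mod K, so q full periods meet every class q times.
    sum-mod : ∀ q → sumℕ (q * K) (λ i → g (i mod K)) ≡ q * sum g
    sum-mod zero    = refl
    sum-mod (suc q) = trans (sumℕ-+ K (q * K) G)
      (cong₂ _+_ period (trans (sum-cong-≗ {q * K} (λ i → cong g (mod-+ (toℕ i)))) (sum-mod q)))

  sumℕ-monoˡ-≤ : ∀ {m n} f → m ≤ n → sumℕ m f ≤ sumℕ n f
  sumℕ-monoˡ-≤ f z≤n     = z≤n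
  sumℕ-monoˡ-≤ f (s≤s p) = +-monoʳ-≤ (f 0) (sumℕ-monoˡ-≤ (f ∘ suc) p)

  -- Sparse triangle-free graphs without large bipartite holes

  𝟙-∨ : ∀ a b → 𝟙 (a ∨ b) ≤ 𝟙 a + 𝟙 b
  𝟙-∨ true  b = s≤s z≤n
  𝟙-∨ false b = ≤-refl

  𝟙-∧ : ∀ a b → 𝟙 (a ∧ b) ≡ 𝟙 a * 𝟙 b
  𝟙-∧ true  b = sym (+-identityʳ _)
  𝟙-∧ false b = refl

  𝟙-true : ∀ {a} → 1 ≤ 𝟙 a → a ≡ true
  𝟙-true {true} _ = refl

  Graph : ℕ → Set
  Graph M = Fin M → Fin M → Bool

  module _ {M : ℕ} where

    deg : Graph M → Fin M → ℕ
    deg F u = sum (λ v → 𝟙 (F u v))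

    codeg : Graph M → Fin M → Fin M → ℕ
    codeg F u v = sum (λ w → 𝟙 (F u w) * 𝟙 (F w v))

    Symmetricᴳ : Graph M → Set
    Symmetricᴳ F = ∀ u v → F u v ≡ F v u

    -- The vertices need not be distinct, so loops are excluded as well.
    TriangleFree : Graph M → Set
    TriangleFree F = ∀ u v w → F u v ≡ true → F v w ≡ true → F u w ≡ true → ⊥

    -- The sum counts walks of length two from `u`: at most Δ middle vertices with at most Δ
    -- continuations each.
    codeg-sum : ∀ F Δ → (∀ u → deg F u ≤ Δ) → ∀ u → sum (codeg F u) ≤ Δ * Δ
    codeg-sum F Δ deg≤ u = begin
      sum (λ v → sum (λ w → 𝟙 (F u w) * 𝟙 (F w v))) ≡⟨ ∑-comm (λ v w → 𝟙 (F u w) * 𝟙 (F w v)) ⟩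
      sum (λ w → sum (λ v → 𝟙 (F u w) * 𝟙 (F w v))) ≡⟨ sum-cong-≗ (λ w → sym (*-distribˡ-sum (𝟙 (F u w)) (λ v → 𝟙 (F w v)))) ⟩
      sum (λ w → 𝟙 (F u w) * deg F w)               ≤⟨ sum-mono-≤ (λ w → *-monoʳ-≤ (𝟙 (F u w)) (deg≤ w)) ⟩
      sum (λ w → 𝟙 (F u w) * Δ)                     ≡⟨ sym (*-distribʳ-sum Δ (λ w → 𝟙 (F u w))) ⟩
      deg F u * Δ                                   ≤⟨ *-monoˡ-≤ Δ (deg≤ u) ⟩
      Δ * Δ ∎
      where open ≤-Reasoning

    1≤codeg : ∀ F {u w v} → F u w ≡ true → F w v ≡ true → 1 ≤ codeg F u v
    1≤codeg F {u} {w} {v} p q = ≤-trans (≤-reflexive (sym (cong₂ (λ x y → 𝟙 x * 𝟙 y) p q)))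
      (term≤sum (λ w → 𝟙 (F u w) * 𝟙 (F w v)) w)

    _==_ : Fin M → Fin M → Bool
    i == j = does (i ≟F j)

    ==-sound : ∀ {i j} → i == j ≡ true → i ≡ j
    ==-sound {i} {j} eq with i ≟F j
    ... | yes p = p

    addEdge : Fin M → Fin M → Graph M → Graph M
    addEdge a b F u v = F u v ∨ ((u == a ∧ v == b) ∨ (u == b ∧ v == a))

    addEdge-sym : ∀ a b F → Symmetricᴳ F → Symmetricᴳ (addEdge a b F)
    addEdge-sym a b F s u v = cong₂ _∨_ (s u v)
      (trans (∨-comm (u == a ∧ v == b) _) (cong₂ _∨_ (∧-comm (u == b) _) (∧-comm (u == a) _)))

    addEdge-⊇ : ∀ a b F u v → F u v ≡ true → addEdge a b F u v ≡ true
    addEdge-⊇ a b F u v eq rewrite eq = refl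

    addEdge-new : ∀ a b F → addEdge a b F a b ≡ true
    addEdge-new a b F with F a b
    ... | true = refl
    ... | false rewrite dec-true (a ≟F a) refl | dec-true (b ≟F b) refl = refl

    addEdge-inv : ∀ a b F u v → addEdge a b F u v ≡ true →
      F u v ≡ true ⊎ (u ≡ a × v ≡ b) ⊎ (u ≡ b × v ≡ a)
    addEdge-inv a b F u v eq with F u v
    ... | true = inj₁ refl
    ... | false with u == a in p | v == b in q | u == b in r | v == a in s
    ... | true  | true  | _    | _    = inj₂ (inj₁ (==-sound p , ==-sound q))
    ... | true  | false | true | true = inj₂ (inj₂ (==-sound r , ==-sound s))
    ... | false | _     | true | true = inj₂ (inj₂ (==-sound r , ==-sound s))

    -- A triangle with one new side gives `a` and `b` a common neighbour. More new sides force
    -- either a = b or a loop of `F`, and a loop is already a degenerate triangle.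
    addEdge-triangleFree : ∀ a b F → Symmetricᴳ F → a ≢ b → (∀ w → F a w ≡ true → F w b ≡ true → ⊥) →
      TriangleFree F → TriangleFree (addEdge a b F)
    addEdge-triangleFree a b F s a≢b nc tf u v w p q r
      with addEdge-inv a b F u v p | addEdge-inv a b F v w q | addEdge-inv a b F u w r
    ... | inj₁ p′ | inj₁ q′ | inj₁ r′ = tf u v w p′ q′ r′
    ... | inj₁ p′ | inj₁ q′ | inj₂ (inj₁ (refl , refl)) = nc v p′ q′
    ... | inj₁ p′ | inj₁ q′ | inj₂ (inj₂ (refl , refl)) = nc v (trans (s a v) q′) (trans (s v b) p′)
    ... | inj₁ p′ | inj₂ (inj₁ (refl , refl)) | inj₁ r′ = nc u (trans (s a u) p′) r′
    ... | inj₁ p′ | inj₂ (inj₂ (refl , refl)) | inj₁ r′ = nc u (trans (s a u) r′) p′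
    ... | inj₂ (inj₁ (refl , refl)) | inj₁ q′ | inj₁ r′ = nc w r′ (trans (s w b) q′)
    ... | inj₂ (inj₂ (refl , refl)) | inj₁ q′ | inj₁ r′ = nc w q′ (trans (s w b) r′)
    ... | inj₁ p′ | inj₂ (inj₁ (refl , refl)) | inj₂ (inj₁ (refl , _)) = tf a a a p′ p′ p′
    ... | inj₁ p′ | inj₂ (inj₁ (refl , refl)) | inj₂ (inj₂ (_ , b≡a)) = a≢b (sym b≡a)
    ... | inj₁ p′ | inj₂ (inj₂ (refl , refl)) | inj₂ (inj₁ (_ , a≡b)) = a≢b a≡b
    ... | inj₁ p′ | inj₂ (inj₂ (refl , refl)) | inj₂ (inj₂ (refl , _)) = tf b b b p′ p′ p′
    ... | inj₂ (inj₁ (refl , refl)) | inj₁ q′ | inj₂ (inj₁ (_ , refl)) = tf b b b q′ q′ q′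
    ... | inj₂ (inj₁ (refl , refl)) | inj₁ q′ | inj₂ (inj₂ (a≡b , _)) = a≢b a≡b
    ... | inj₂ (inj₂ (refl , refl)) | inj₁ q′ | inj₂ (inj₁ (b≡a , _)) = a≢b (sym b≡a)
    ... | inj₂ (inj₂ (refl , refl)) | inj₁ q′ | inj₂ (inj₂ (_ , refl)) = tf a a a q′ q′ q′
    ... | inj₂ (inj₁ (refl , refl)) | inj₂ (inj₁ (b≡a , _)) | _ = a≢b (sym b≡a)
    ... | inj₂ (inj₂ (refl , refl)) | inj₂ (inj₂ (a≡b , _)) | _ = a≢b a≡b
    ... | inj₂ (inj₁ (refl , refl)) | inj₂ (inj₂ (refl , refl)) | inj₁ r′ = tf a a a r′ r′ r′
    ... | inj₂ (inj₁ (refl , refl)) | inj₂ (inj₂ (refl , refl)) | inj₂ (inj₁ (_ , a≡b)) = a≢b a≡b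
    ... | inj₂ (inj₁ (refl , refl)) | inj₂ (inj₂ (refl , refl)) | inj₂ (inj₂ (a≡b , _)) = a≢b a≡b
    ... | inj₂ (inj₂ (refl , refl)) | inj₂ (inj₁ (refl , refl)) | inj₁ r′ = tf b b b r′ r′ r′
    ... | inj₂ (inj₂ (refl , refl)) | inj₂ (inj₁ (refl , refl)) | inj₂ (inj₁ (b≡a , _)) = a≢b (sym b≡a)
    ... | inj₂ (inj₂ (refl , refl)) | inj₂ (inj₁ (refl , refl)) | inj₂ (inj₂ (_ , b≡a)) = a≢b (sym b≡a)

    sum-δʳ : ∀ (j : Fin M) → sum (λ i → δ i j) ≤ 1
    sum-δʳ j = sum≤single _ 1 (λ i → 𝟙≤1 (i == j)) (λ i i′ p q → trans (δ≥1⇒≡ p) (sym (δ≥1⇒≡ q)))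

    deg-addEdge : ∀ a b F u → deg (addEdge a b F) u ≤ deg F u + (δ u a + δ u b)
    deg-addEdge a b F u = begin
      sum (λ v → 𝟙 (addEdge a b F u v))
        ≤⟨ sum-mono-≤ (λ v → ≤-trans (𝟙-∨ (F u v) _) (+-monoʳ-≤ (𝟙 (F u v)) (≤-trans (𝟙-∨ (u == a ∧ v == b) _)
             (≤-reflexive (cong₂ _+_ (𝟙-∧ (u == a) (v == b)) (𝟙-∧ (u == b) (v == a))))))) ⟩
      sum (λ v → 𝟙 (F u v) + (δ u a * δ v b + δ u b * δ v a))
        ≡⟨ trans (∑-distrib-+ (λ v → 𝟙 (F u v)) _) (cong (deg F u +_) (∑-distrib-+ (λ v → δ u a * δ v b) _)) ⟩
      deg F u + (sum (λ v → δ u a * δ v b) + sum (λ v → δ u b * δ v a))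
        ≤⟨ +-monoʳ-≤ (deg F u) (+-mono-≤ (row a b) (row b a)) ⟩
      deg F u + (δ u a + δ u b) ∎
      where
      open ≤-Reasoning
      row : ∀ c d → sum (λ v → δ u c * δ v d) ≤ δ u c
      row c d = begin
        sum (λ v → δ u c * δ v d) ≡⟨ sym (*-distribˡ-sum (δ u c) (λ v → δ v d)) ⟩
        δ u c * sum (λ v → δ v d) ≤⟨ *-monoʳ-≤ (δ u c) (sum-δʳ d) ⟩
        δ u c * 1                 ≡⟨ *-identityʳ _ ⟩
        δ u c ∎

    sum-deg-addEdge : ∀ a b F → sum (deg (addEdge a b F)) ≤ sum (deg F) + 2
    sum-deg-addEdge a b F = begin
      sum (deg (addEdge a b F))                  ≤⟨ sum-mono-≤ (deg-addEdge a b F) ⟩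
      sum (λ u → deg F u + (δ u a + δ u b))      ≡⟨ trans (∑-distrib-+ (deg F) _) (cong (sum (deg F) +_) (∑-distrib-+ (λ u → δ u a) _)) ⟩
      sum (deg F) + (sum (λ u → δ u a) + sum (λ u → δ u b)) ≤⟨ +-monoʳ-≤ (sum (deg F)) (+-mono-≤ (sum-δʳ a) (sum-δʳ b)) ⟩
      sum (deg F) + 2 ∎
      where open ≤-Reasoning

    deg-addEdge-≤ : ∀ a b F Δ → a ≢ b → deg F a < Δ → deg F b < Δ → (∀ u → deg F u ≤ Δ) →
      ∀ u → deg (addEdge a b F) u ≤ Δ
    deg-addEdge-≤ a b F Δ a≢b a<Δ b<Δ deg≤ u = ≤-trans (deg-addEdge a b F u) bound
      where
      bound : deg F u + (δ u a + δ u b) ≤ Δ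
      bound with u ≟F a | u ≟F b
      ... | yes refl | yes refl = ⊥-elim (a≢b refl)
      ... | yes refl | no _     = ≤-trans (≤-reflexive (+-comm (deg F u) 1)) a<Δ
      ... | no _     | yes refl = ≤-trans (≤-reflexive (+-comm (deg F u) 1)) b<Δ
      ... | no _     | no _     = ≤-trans (≤-reflexive (+-identityʳ _)) (deg≤ u)

  -- Greedy choice of edges between all pairs of large sets

  size : ∀ {M} → Vec Bool M → ℕ
  size X = sum (λ x → 𝟙 (lookup X x))

  -- Sets of labels are vectors here, since list membership needs an equality that functions would
  -- have only up to extensionality.
  allVecs : ∀ M → List (Vec Bool M)
  allVecs zero    = [] ∷ []
  allVecs (suc M) = List.map (true ∷_) (allVecs M) List.++ List.map (false ∷_) (allVecs M)

  length-allVecs : ∀ M → length (allVecs M) ≡ 2 ^ M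
  length-allVecs zero    = refl
  length-allVecs (suc M) = trans (List.length-++ (List.map (true ∷_) (allVecs M)))
    (cong₂ _+_ (trans (List.length-map _ (allVecs M)) (length-allVecs M))
               (trans (trans (List.length-map _ (allVecs M)) (length-allVecs M)) (sym (+-identityʳ _))))

  ∈-allVecs : ∀ {M} (X : Vec Bool M) → X ∈ allVecs M
  ∈-allVecs []          = here refl
  ∈-allVecs (true  ∷ X) = ∈-++⁺ˡ (∈-map⁺ _ (∈-allVecs X))
  ∈-allVecs (false ∷ X) = ∈-++⁺ʳ (List.map (true ∷_) (allVecs _)) (∈-map⁺ _ (∈-allVecs X))

  length-cartesianProduct : ∀ {A B : Set} (xs : List A) (ys : List B) →
    length (cartesianProduct xs ys) ≡ length xs * length ys
  length-cartesianProduct []       ys = refl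
  length-cartesianProduct (x ∷ xs) ys = trans (List.length-++ (List.map (x ,_) ys))
    (cong₂ _+_ (List.length-map _ ys) (length-cartesianProduct xs ys))

  VecPair : ℕ → Set
  VecPair M = Vec Bool M × Vec Bool M

  hits : ∀ {M} → VecPair M → Fin M → Fin M → Bool
  hits (X , Y) x y = lookup X x ∧ lookup Y y

  hitCount : ∀ {M} → List (VecPair M) → Fin M → Fin M → ℕ
  hitCount []      x y = 0
  hitCount (p ∷ W) x y = 𝟙 (hits p x y) + hitCount W x y

  unhit : ∀ {M} → Fin M → Fin M → List (VecPair M) → List (VecPair M)
  unhit x y []      = []
  unhit x y (p ∷ W) = if hits p x y then unhit x y W else p ∷ unhit x y W

  length-unhit : ∀ {M} x y (W : List (VecPair M)) → length (unhit x y W) + hitCount W x y ≡ length W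
  length-unhit x y []      = refl
  length-unhit x y (p ∷ W) with hits p x y
  ... | true  = trans (+-suc _ _) (cong suc (length-unhit x y W))
  ... | false = cong suc (length-unhit x y W)

  All-unhit : ∀ {M} {P : VecPair M → Set} x y {W} → All P W → All P (unhit x y W)
  All-unhit x y []       = []
  All-unhit x y {p ∷ W} (Pp ∷ PW) with hits p x y
  ... | true  = All-unhit x y PW
  ... | false = Pp ∷ All-unhit x y PW

  ∈-unhit : ∀ {M} x y {p} {W : List (VecPair M)} → p ∈ W → hits p x y ≡ true ⊎ p ∈ unhit x y W
  ∈-unhit x y {p} (here {xs = W} refl) with hits p x y
  ... | true  = inj₁ refl
  ... | false = inj₂ (here refl)
  ∈-unhit x y {p} (there {x = p′} p∈W) with ∈-unhit x y p∈W
  ... | inj₁ h = inj₁ h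
  ... | inj₂ i with hits p′ x y
  ...   | true  = inj₂ i
  ...   | false = inj₂ (there i)

  sum² : ∀ {M} → (Fin M → Fin M → ℕ) → ℕ
  sum² f = sum (λ x → sum (f x))

  sum²-+ : ∀ {M} (f g : Fin M → Fin M → ℕ) → sum² (λ x y → f x y + g x y) ≡ sum² f + sum² g
  sum²-+ f g = trans (sum-cong-≗ (λ x → ∑-distrib-+ (f x) (g x))) (∑-distrib-+ (sum ∘ f) (sum ∘ g))

  sum²-mono-≤ : ∀ {M} {f g : Fin M → Fin M → ℕ} → (∀ x y → f x y ≤ g x y) → sum² f ≤ sum² g
  sum²-mono-≤ le = sum-mono-≤ (λ x → sum-mono-≤ (le x))

  ∧-true : ∀ {a b} → a ∧ b ≡ true → a ≡ true × b ≡ true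
  ∧-true {true} {true} _ = refl , refl

  *-indicator-≤ : ∀ {a b} (d : Dec (a ≤ b)) → 𝟙 (does d) * a ≤ b
  *-indicator-≤ {a} (yes p) = ≤-trans (≤-reflexive (*-identityˡ a)) p
  *-indicator-≤     (no  _) = z≤n

  obstruction-cases : ∀ {E : Set} {a b c Δ} (e : Dec E) (a< : Dec (a < Δ)) (a≥ : Dec (Δ ≤ a)) (b< : Dec (b < Δ)) (b≥ : Dec (Δ ≤ b)) (c₀ : Dec (c ≡ 0)) →
    1 ≤ 𝟙 (does (¬? e ×-dec a< ×-dec b< ×-dec c₀)) + (𝟙 (does e) + (𝟙 (does a≥) + 𝟙 (does b≥)) + c)
  obstruction-cases (yes _) _       _       _       _       _       = s≤s z≤n
  obstruction-cases (no _)  (no p)  (no q)  _       _       _       = ⊥-elim (p (≰⇒> q))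
  obstruction-cases (no _)  (no _)  (yes _) _       _       _       = s≤s z≤n
  obstruction-cases (no _)  (yes _) (yes _) (no _)  _       _       = s≤s z≤n
  obstruction-cases (no _)  (yes _) (no _)  (no p)  (no q)  _       = ⊥-elim (p (≰⇒> q))
  obstruction-cases (no _)  (yes _) (no _)  (no _)  (yes _) _       = s≤s z≤n
  obstruction-cases (no _)  (yes _) _       (yes _) _       (yes _) = s≤s z≤n
  obstruction-cases {c = zero}  (no _) (yes _) _ (yes _) _ (no c≢0) = ⊥-elim (c≢0 refl)
  obstruction-cases {c = suc c} (no _) (yes _) a≥ (yes _) b≥ (no _) = ≤-trans (s≤s z≤n) (m≤n+m (suc c) (𝟙 (does a≥) + 𝟙 (does b≥)))

  -- `dense`: with at most 2m / Δ saturated vertices, the allowed pairs between two sets of size h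
  -- form a proportion of at least 1 / D of all M² pairs. `enough`: the 4^M pairs of sets, reduced m
  -- times by the factor 1 - 1 / D, fall below one.
  module Greedy
    (M h Δ D-1 m : ℕ) .{{_ : NonZero M}}
    (dense : ∀ full hit → full * Δ ≤ 2 * m → h * h ≤ hit + (M + (M * full + M * full) + M * (Δ * Δ)) → M * M ≤ suc D-1 * hit)
    (enough : (2 ^ M * 2 ^ M) * D-1 ^ m < suc D-1 ^ m)
    where

    D = suc D-1

    Big : VecPair M → Set
    Big (X , Y) = h ≤ size X × h ≤ size Y

    big? : ∀ p → Dec (Big p)
    big? (X , Y) = (h ≤? size X) ×-dec (h ≤? size Y)

    Hit : Graph M → VecPair M → Set
    Hit F p = ∃₂ λ x y → hits p x y ≡ true × F x y ≡ true

    -- The graph after s edges; waiting lists the pairs of big sets it may still miss.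
    record Partial (s : ℕ) : Set where
      field
        graph        : Graph M
        waiting      : List (VecPair M)
        symmetric    : Symmetricᴳ graph
        triangleFree : TriangleFree graph
        deg≤         : ∀ u → deg graph u ≤ Δ
        degSum≤      : sum (deg graph) ≤ 2 * s
        waiting-big  : All Big waiting
        covered      : ∀ p → Big p → Hit graph p ⊎ p ∈ waiting
        waiting≤     : length waiting * D ^ s ≤ (2 ^ M * 2 ^ M) * D-1 ^ s

    initial : Partial 0
    initial = record
      { graph        = λ _ _ → false
      ; waiting      = filter big? pairs
      ; symmetric    = λ _ _ → refl
      ; triangleFree = λ _ _ _ ()
      ; deg≤         = λ u → subst (_≤ Δ) (sym (zeroes M)) z≤n
      ; degSum≤      = ≤-reflexive (trans (sum-cong-≗ {M} (λ _ → zeroes M)) (zeroes M))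
      ; waiting-big  = all-filter big? pairs
      ; covered      = λ p b → inj₂ (∈-filter⁺ big? (∈-cartesianProduct⁺ (∈-allVecs _) (∈-allVecs _)) b)
      ; waiting≤     = *-monoˡ-≤ 1 (≤-trans (List.length-filter big? pairs)
                         (≤-reflexive (trans (length-cartesianProduct (allVecs M) (allVecs M))
                           (cong₂ _*_ (length-allVecs M) (length-allVecs M)))))
      }
      where
      pairs = cartesianProduct (allVecs M) (allVecs M)
      zeroes : ∀ n → sum {n} (λ _ → 0) ≡ 0
      zeroes n = trans (sum-const n 0) (*-zeroʳ n)

    module Step {s : ℕ} (s≤m : s ≤ m) (st : Partial s) where
      open Partial st renaming (graph to F; waiting to W)

      Allowed : Fin M → Fin M → Set
      Allowed x y = x ≢ y × deg F x < Δ × deg F y < Δ × codeg F x y ≡ 0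

      allowed? : ∀ x y → Dec (Allowed x y)
      allowed? x y = ¬? (x ≟F y) ×-dec (deg F x <? Δ) ×-dec (deg F y <? Δ) ×-dec (codeg F x y ≟ 0)

      A : Fin M → Fin M → ℕ
      A x y = 𝟙 (does (allowed? x y))

      full : Fin M → ℕ
      full x = 𝟙 (does (Δ ≤? deg F x))

      #full : ℕ
      #full = sum full

      -- Every saturated vertex contributes Δ to the degree sum, which grows by at most 2 per edge.
      full-bound : #full * Δ ≤ 2 * m
      full-bound = begin
        #full * Δ               ≡⟨ *-distribʳ-sum Δ full ⟩
        sum (λ x → full x * Δ)  ≤⟨ sum-mono-≤ term ⟩
        sum (deg F)             ≤⟨ degSum≤ ⟩
        2 * s                   ≤⟨ *-monoʳ-≤ 2 s≤m ⟩
        2 * m ∎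
        where
        open ≤-Reasoning
        term : ∀ x → full x * Δ ≤ deg F x
        term x = *-indicator-≤ (Δ ≤? deg F x)

      obstruction : Fin M → Fin M → ℕ
      obstruction x y = δ x y + (full x + full y) + codeg F x y

      allowed-or-obstructed : ∀ x y → 1 ≤ A x y + obstruction x y
      allowed-or-obstructed x y = obstruction-cases (x ≟F y) (deg F x <? Δ) (Δ ≤? deg F x) (deg F y <? Δ) (Δ ≤? deg F y) (codeg F x y ≟ 0)

      -- The three terms are the diagonal, the rows and columns of saturated vertices, and the walks
      -- of length two.
      obstruction-sum : sum² obstruction ≤ M + (M * #full + M * #full) + M * (Δ * Δ)
      obstruction-sum = begin
        sum² obstruction
          ≡⟨ sum²-+ (λ x y → δ x y + (full x + full y)) (codeg F) ⟩
        sum² (λ x y → δ x y + (full x + full y)) + sum² (codeg F)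
          ≡⟨ cong (_+ sum² (codeg F)) (trans (sum²-+ δ (λ x y → full x + full y)) (cong (sum² {M} δ +_) (sum²-+ (λ x _ → full x) (λ _ y → full y)))) ⟩
        sum² {M} δ + (sum² (λ x _ → full x) + sum² (λ _ y → full y)) + sum² (codeg F)
          ≤⟨ +-mono-≤ (+-mono-≤ diag (≤-reflexive (cong₂ _+_ left (sum-const M #full)))) codegs ⟩
        M + (M * #full + M * #full) + M * (Δ * Δ) ∎
        where
        open ≤-Reasoning
        diag : sum² {M} δ ≤ M
        diag = begin
          sum² {M} δ                      ≡⟨ ∑-comm (δ {M}) ⟩
          sum {M} (λ j → sum {M} (λ i → δ i j)) ≤⟨ sum-mono-≤ {M} sum-δʳ ⟩
          sum {M} (λ _ → 1)               ≡⟨ trans (sum-const M 1) (*-identityʳ M) ⟩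
          M ∎
        left : sum² (λ x _ → full x) ≡ M * #full
        left = trans (∑-comm (λ x (_ : Fin M) → full x)) (sum-const M #full)
        codegs : sum² (codeg F) ≤ M * (Δ * Δ)
        codegs = ≤-trans (sum-mono-≤ (codeg-sum F Δ deg≤)) (≤-reflexive (sum-const M (Δ * Δ)))

      -- The product X × Y has at least h² pairs and loses at most the total obstruction; `dense`
      -- compares the rest with M².
      many-allowed : ∀ p → Big p → M * M ≤ D * sum² (λ x y → A x y * 𝟙 (hits p x y))
      many-allowed p@(X , Y) (h≤X , h≤Y) = dense #full _ full-bound (begin
        h * h ≤⟨ *-mono-≤ h≤X h≤Y ⟩
        size X * size Y
          ≡⟨ trans (*-distribʳ-sum (size Y) (λ x → 𝟙 (lookup X x)))
               (sum-cong-≗ (λ x → trans (*-distribˡ-sum (𝟙 (lookup X x)) (λ y → 𝟙 (lookup Y y)))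
                 (sum-cong-≗ (λ y → sym (𝟙-∧ (lookup X x) (lookup Y y)))))) ⟩
        sum² (λ x y → 𝟙 (hits p x y))
          ≤⟨ sum²-mono-≤ (λ x y → term {a = A x y} (𝟙≤1 (hits p x y)) (allowed-or-obstructed x y)) ⟩
        sum² (λ x y → A x y * 𝟙 (hits p x y) + obstruction x y)
          ≡⟨ sum²-+ (λ x y → A x y * 𝟙 (hits p x y)) obstruction ⟩
        sum² (λ x y → A x y * 𝟙 (hits p x y)) + sum² obstruction
          ≤⟨ +-monoʳ-≤ _ obstruction-sum ⟩
        sum² (λ x y → A x y * 𝟙 (hits p x y)) + (M + (M * #full + M * #full) + M * (Δ * Δ)) ∎)
        where
        open ≤-Reasoning
        term : ∀ {i a o} → i ≤ 1 → 1 ≤ a + o → i ≤ a * i + o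
        term {zero}         _ _ = z≤n
        term {suc zero} {a} {o} _ le = subst (λ t → 1 ≤ t + o) (sym (*-identityʳ a)) le
        term {suc (suc _)} (s≤s ()) _

      averaged : ∀ W → All Big W → length W * (M * M) ≤ D * sum² (λ x y → A x y * hitCount W x y)
      averaged []      []       = z≤n
      averaged (p ∷ W) (b ∷ bs) = begin
        M * M + length W * (M * M)
          ≤⟨ +-mono-≤ (many-allowed p b) (averaged W bs) ⟩
        D * sum² (λ x y → A x y * 𝟙 (hits p x y)) + D * sum² (λ x y → A x y * hitCount W x y)
          ≡⟨ sym (*-distribˡ-+ D (sum² (λ x y → A x y * 𝟙 (hits p x y))) _) ⟩
        D * (sum² (λ x y → A x y * 𝟙 (hits p x y)) + sum² (λ x y → A x y * hitCount W x y))
          ≡⟨ cong (D *_) (sym (sum²-+ (λ x y → A x y * 𝟙 (hits p x y)) _)) ⟩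
        D * sum² (λ x y → A x y * 𝟙 (hits p x y) + A x y * hitCount W x y)
          ≡⟨ cong (D *_) (sum-cong-≗ (λ x → sum-cong-≗ (λ y → sym (*-distribˡ-+ (A x y) (𝟙 (hits p x y)) _)))) ⟩
        D * sum² (λ x y → A x y * hitCount (p ∷ W) x y) ∎
        where open ≤-Reasoning

      -- Double counting of waiting pairs against allowed edges, then averaging over rows and over
      -- the entries of one row.
      good-edge : ∃₂ λ x y → length W ≤ D * (A x y * hitCount W x y)
      good-edge with average-≤-term (λ x → sum (λ y → D * (A x y * hitCount W x y))) (M * length W) (begin
          M * (M * length W) ≡⟨ trans (sym (*-assoc M M (length W))) (*-comm (M * M) (length W)) ⟩
          length W * (M * M) ≤⟨ averaged W waiting-big ⟩
          D * sum² (λ x y → A x y * hitCount W x y)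
            ≡⟨ trans (*-distribˡ-sum D (λ x → sum (λ y → A x y * hitCount W x y))) (sum-cong-≗ (λ x → *-distribˡ-sum D (λ y → A x y * hitCount W x y))) ⟩
          sum² (λ x y → D * (A x y * hitCount W x y)) ∎)
        where open ≤-Reasoning
      ... | x , le with average-≤-term (λ y → D * (A x y * hitCount W x y)) (length W) le
      ...   | y , le′ = x , y , le′

      extend : ∀ a b (al : Dec (Allowed a b)) → length W ≤ D * (𝟙 (does al) * hitCount W a b) → Partial (suc s)
      -- For a pair that is not allowed the bound `le` reads `length W` ≤ 0: nothing is waiting and
      -- the graph can stay as it is.
      extend a b (no _) le = record
        { graph = F ; waiting = W ; symmetric = symmetric ; triangleFree = triangleFree ; deg≤ = deg≤
        ; degSum≤ = ≤-trans degSum≤ (*-monoʳ-≤ 2 (n≤1+n s))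
        ; waiting-big = waiting-big ; covered = covered
        ; waiting≤ = ≤-trans (*-monoˡ-≤ (D ^ suc s) (≤-trans le (≤-reflexive (*-zeroʳ D)))) z≤n
        }
      extend a b (yes (a≢b , a<Δ , b<Δ , cod≡0)) le = record
        { graph        = addEdge a b F
        ; waiting      = W′
        ; symmetric    = addEdge-sym a b F symmetric
        ; triangleFree = addEdge-triangleFree a b F symmetric a≢b no-common triangleFree
        ; deg≤         = deg-addEdge-≤ a b F Δ a≢b a<Δ b<Δ deg≤
        ; degSum≤      = ≤-trans (sum-deg-addEdge a b F) (≤-trans (+-monoˡ-≤ 2 degSum≤) (≤-reflexive (trans (+-comm (2 * s) 2) (sym (*-suc 2 s)))))
        ; waiting-big  = All-unhit a b waiting-big
        ; covered      = cover
        ; waiting≤     = begin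
            length W′ * (D * D ^ s)     ≡⟨ sym (*-assoc (length W′) D (D ^ s)) ⟩
            length W′ * D * D ^ s       ≤⟨ *-monoˡ-≤ (D ^ s) shrink ⟩
            D-1 * length W * D ^ s      ≡⟨ *-assoc D-1 (length W) (D ^ s) ⟩
            D-1 * (length W * D ^ s)    ≤⟨ *-monoʳ-≤ D-1 waiting≤ ⟩
            D-1 * ((2 ^ M * 2 ^ M) * D-1 ^ s) ≡⟨ trans (sym (*-assoc D-1 (2 ^ M * 2 ^ M) (D-1 ^ s))) (trans (cong (_* D-1 ^ s) (*-comm D-1 (2 ^ M * 2 ^ M))) (*-assoc (2 ^ M * 2 ^ M) D-1 (D-1 ^ s))) ⟩
            (2 ^ M * 2 ^ M) * D-1 ^ suc s ∎
        }
        where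
        open ≤-Reasoning
        W′ = unhit a b W
        no-common : ∀ w → F a w ≡ true → F w b ≡ true → ⊥
        no-common w p q = <⇒≱ (1≤codeg F p q) (≤-reflexive cod≡0)
        cover : ∀ p → Big p → Hit (addEdge a b F) p ⊎ p ∈ W′
        cover p big with covered p big
        ... | inj₁ (x , y , hit , e) = inj₁ (x , y , hit , addEdge-⊇ a b F x y e)
        ... | inj₂ p∈W with ∈-unhit a b p∈W
        ...   | inj₁ hit = inj₁ (a , b , hit , addEdge-new a b F)
        ...   | inj₂ i   = inj₂ i
        -- By `le` the new edge hits at least 1 / D of the waiting pairs.
        shrink : length W′ * D ≤ D-1 * length W
        shrink = +-cancelʳ-≤ (length W) _ _ (begin
          length W′ * D + length W                 ≤⟨ +-monoʳ-≤ (length W′ * D) le ⟩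
          length W′ * D + D * (1 * hitCount W a b) ≡⟨ cong₂ _+_ (*-comm (length W′) D) (cong (D *_) (*-identityˡ _)) ⟩
          D * length W′ + D * hitCount W a b       ≡⟨ sym (*-distribˡ-+ D (length W′) _) ⟩
          D * (length W′ + hitCount W a b)         ≡⟨ cong (D *_) (length-unhit a b W) ⟩
          length W + D-1 * length W                ≡⟨ +-comm (length W) _ ⟩
          D-1 * length W + length W ∎)

      step : Partial (suc s)
      step with a , b , le ← good-edge = extend a b (allowed? a b) le

    stage : ∀ s → s ≤ m → Partial s
    stage zero    _   = initial
    stage (suc s) s<m = Step.step (<⇒≤ s<m) (stage s (<⇒≤ s<m))

    open Partial (stage m ≤-refl) public using (graph; symmetric; triangleFree; deg≤)

    -- A pair still waiting after m steps would give D^m ≤ 4^M (D - 1)^m, against `enough`.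
    hole-free : ∀ p → Big p → Hit graph p
    hole-free p big with Partial.covered (stage m ≤-refl) p big
    ... | inj₁ hit = hit
    ... | inj₂ p∈W = ⊥-elim (<⇒≱ enough (begin
      D ^ m                      ≤⟨ m≤m*n (D ^ m) (length W) ⟩
      D ^ m * length W           ≡⟨ *-comm (D ^ m) (length W) ⟩
      length W * D ^ m           ≤⟨ Partial.waiting≤ (stage m ≤-refl) ⟩
      (2 ^ M * 2 ^ M) * D-1 ^ m  ∎))
      where
      open ≤-Reasoning
      W = Partial.waiting (stage m ≤-refl)
      nonempty : ∀ {A : Set} {x : A} {xs} → x ∈ xs → NonZero (length xs)
      nonempty (here _)  = _
      nonempty (there _) = _
      instance
        W≢0 : NonZero (length W)
        W≢0 = nonempty p∈W

  -- The number of greedy steps and the parameters of the label graph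

  bernoulli : ∀ n k → n ^ suc k + suc k * n ^ k ≤ suc n ^ suc k
  bernoulli n zero    = ≤-reflexive (+-comm (n * 1) 1)
  bernoulli n (suc k) = begin
    n * (n * p) + suc (suc k) * (n * p)                  ≤⟨ m≤m+n _ (suc k * p) ⟩
    n * (n * p) + suc (suc k) * (n * p) + suc k * p      ≡⟨ expand n k p ⟩
    suc n * (n * p + suc k * p)                          ≤⟨ *-monoʳ-≤ (suc n) (bernoulli n k) ⟩
    suc n * suc n ^ suc k ∎
    where
    open ≤-Reasoning
    p = n ^ k
    expand : ∀ n k p → n * (n * p) + suc (suc k) * (n * p) + suc k * p ≡ suc n * (n * p + suc k * p)
    expand = solve-∀

  -- This is (1 + 1/n)^(n+1) ≥ 2 with denominators cleared, from the first two binomial terms.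
  doubling : ∀ n → 2 * n ^ suc n ≤ suc n ^ suc n
  doubling n = ≤-trans (+-monoʳ-≤ (n ^ suc n) (≤-trans (≤-reflexive (+-identityʳ _)) (*-monoˡ-≤ (n ^ n) (n≤1+n n)))) (bernoulli n n)

  ^-distribʳ-* : ∀ r m n → (m * n) ^ r ≡ m ^ r * n ^ r
  ^-distribʳ-* zero    m n = refl
  ^-distribʳ-* (suc r) m n = trans (cong (m * n *_) (^-distribʳ-* r m n)) ([m*n]*[o*p]≡[m*o]*[n*p] m n (m ^ r) (n ^ r))

  -- By `doubling`, each block of n + 1 steps gains a factor 2, and 2M + 1 blocks beat the 4^M pairs
  -- of sets.
  power-gap : ∀ n .{{_ : NonZero n}} M → (2 ^ M * 2 ^ M) * n ^ (suc n * (2 * M + 1)) < suc n ^ (suc n * (2 * M + 1))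
  power-gap n M = begin-strict
    (2 ^ M * 2 ^ M) * n ^ (suc n * r) <⟨ *-monoˡ-< (n ^ (suc n * r)) {{m^n≢0 n (suc n * r)}} (m<m+n (2 ^ M * 2 ^ M) (*-mono-≤ (m^n>0 2 M) (m^n>0 2 M))) ⟩
    (2 ^ M * 2 ^ M + 2 ^ M * 2 ^ M) * n ^ (suc n * r) ≡⟨ cong₂ _*_ double (sym (^-*-assoc n (suc n) r)) ⟩
    2 ^ r * (n ^ suc n) ^ r   ≡⟨ sym (^-distribʳ-* r 2 (n ^ suc n)) ⟩
    (2 * n ^ suc n) ^ r       ≤⟨ ^-monoˡ-≤ r (doubling n) ⟩
    (suc n ^ suc n) ^ r       ≡⟨ ^-*-assoc (suc n) (suc n) r ⟩
    suc n ^ (suc n * r) ∎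
    where
    open ≤-Reasoning
    r = 2 * M + 1
    double : 2 ^ M * 2 ^ M + 2 ^ M * 2 ^ M ≡ 2 ^ r
    double = trans (cong (λ x → x + x) (sym (^-distribˡ-+-* 2 M M)))
      (trans (cong (2 ^ (M + M) +_) (sym (+-identityʳ _))) (cong (2 ^_) (exponent M)))
      where
      exponent : ∀ M → 1 + (M + M) ≡ 2 * M + 1
      exponent = solve-∀

  -- `sparse` bounds the purple pairs that must be dropped at a label; `holeFree` yields a red edge
  -- between two far clusters that are both met in at least h labels.
  record LabelGraph (M h B : ℕ) : Set where
    field
      F            : Graph M
      symmetric    : Symmetricᴳ F
      triangleFree : TriangleFree F
      sparse       : ∀ u → sum (λ v → 𝟙 (F u v) + codeg F u v) ≤ B
      holeFree     : ∀ (X Y : Fin M → Bool) → h ≤ sum (𝟙 ∘ X) → h ≤ sum (𝟙 ∘ Y) →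
                     ∃₂ λ x y → X x ≡ true × Y y ≡ true × F x y ≡ true

  module _ (k : ℕ) .{{_ : NonZero k}} where

    private
      -- With M = kh and m = D (2M + 1), D = 2k², the degree sum is at most 12k³h, so this value
      -- leaves at most h / 8k saturated vertices.
      Δ : ℕ
      Δ = 96 * (k * k * k * k)

      k³≢0 : NonZero (12 * (k * k * k))
      k³≢0 = m*n≢0 12 (k * k * k) {{_}} {{m*n≢0 (k * k) k {{m*n≢0 k k}}}}

      1≤k : 1 ≤ k
      1≤k = >-nonZero⁻¹ k

    -- The degree bound depends on k alone. For large h, the diagonal and the walks of length two
    -- therefore cost at most a quarter of h².
    sparseLabelGraph : ∀ h → 4 * k * (1 + Δ * Δ) ≤ h → LabelGraph (k * h) h (Δ + Δ * Δ)
    sparseLabelGraph h big = record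
      { F            = G.graph
      ; symmetric    = G.symmetric
      ; triangleFree = G.triangleFree
      ; sparse       = λ u → ≤-trans (≤-reflexive (∑-distrib-+ (λ v → 𝟙 (G.graph u v)) (codeg G.graph u)))
                         (+-mono-≤ (G.deg≤ u) (codeg-sum G.graph Δ G.deg≤ u))
      ; holeFree     = λ X Y hX hY → let x , y , hit , e = G.hole-free (Vec.tabulate X , Vec.tabulate Y) (size-tabulate X hX , size-tabulate Y hY)
                                         p , q = ∧-true hit
                                     in x , y , trans (sym (lookup∘tabulate X x)) p , trans (sym (lookup∘tabulate Y y)) q , e
      }
      where
      open ≤-Reasoning
      M = k * h
      D = 2 * (k * k)
      D-1 = pred D
      D≥2 : 2 ≤ D
      D≥2 = *-monoʳ-≤ 2 (*-mono-≤ 1≤k 1≤k)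
      D≡ : suc D-1 ≡ D
      D≡ = suc-pred D {{>-nonZero (≤-trans (s≤s z≤n) D≥2)}}
      -- 2M + 1 blocks of D steps, as `power-gap` requires.
      m = suc D-1 * (2 * M + 1)
      1≤h : 1 ≤ h
      1≤h = ≤-trans (*-mono-≤ (*-mono-≤ {1} {4} (s≤s z≤n) 1≤k) (s≤s z≤n)) big
      1≤M : 1 ≤ M
      1≤M = *-mono-≤ 1≤k 1≤h
      instance
        M≢0 : NonZero M
        M≢0 = >-nonZero 1≤M
        D-1≢0 : NonZero D-1
        D-1≢0 = >-nonZero (pred-mono-≤ D≥2)
      size-tabulate : ∀ {n} (X : Fin n → Bool) → h ≤ sum (𝟙 ∘ X) → h ≤ size (Vec.tabulate X)
      size-tabulate X le = ≤-trans le (≤-reflexive (sum-cong-≗ (λ x → cong 𝟙 (sym (lookup∘tabulate X x)))))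

      few-full : ∀ f → f * Δ ≤ 2 * m → 8 * k * f ≤ h
      few-full f le = *-cancelʳ-≤ (8 * k * f) h (12 * (k * k * k)) {{k³≢0}} (begin
        8 * k * f * (12 * (k * k * k)) ≡⟨ regroup k f ⟩
        f * (96 * (k * k * k * k))     ≤⟨ le ⟩
        2 * (suc D-1 * (2 * M + 1))    ≡⟨ cong (λ d → 2 * (d * (2 * M + 1))) D≡ ⟩
        2 * (D * (2 * M + 1))          ≤⟨ *-monoʳ-≤ 2 (*-monoʳ-≤ D (+-monoʳ-≤ (2 * M) 1≤M)) ⟩
        2 * (D * (2 * M + M))          ≡⟨ collect k h ⟩
        h * (12 * (k * k * k)) ∎)
        where
        regroup : ∀ k f → 8 * k * f * (12 * (k * k * k)) ≡ f * (96 * (k * k * k * k))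
        regroup = solve-∀
        collect : ∀ k h → 2 * (2 * (k * k) * (2 * (k * h) + k * h)) ≡ h * (12 * (k * k * k))
        collect = solve-∀

      -- At most h / 8k vertices are saturated, so half of the ≥ h² = M² / k² pairs stay allowed.
      dense : ∀ f hit → f * Δ ≤ 2 * m → h * h ≤ hit + (M + (M * f + M * f) + M * (Δ * Δ)) → M * M ≤ suc D-1 * hit
      dense f hit le le′ = *-cancelˡ-≤ 2 (begin
        2 * (M * M)               ≡⟨ rearr k h ⟩
        k * k * (2 * (h * h))     ≤⟨ *-monoʳ-≤ (k * k) half ⟩
        k * k * (4 * hit)         ≡⟨ rearr′ k hit ⟩
        2 * (D * hit)             ≡⟨ cong (λ d → 2 * (d * hit)) (sym D≡) ⟩
        2 * (suc D-1 * hit) ∎)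
        where
        rearr : ∀ k h → 2 * (k * h * (k * h)) ≡ k * k * (2 * (h * h))
        rearr = solve-∀
        rearr′ : ∀ k t → k * k * (4 * t) ≡ 2 * (2 * (k * k) * t)
        rearr′ = solve-∀
        expand : ∀ k h f t d → 4 * (t + (k * h + (k * h * f + k * h * f) + k * h * d)) ≡ 4 * t + (8 * k * f * h + 4 * k * (1 + d) * h)
        expand = solve-∀
        quarter : ∀ x → 4 * x ≡ 2 * x + (x + x)
        quarter = solve-∀
        half : 2 * (h * h) ≤ 4 * hit
        half = +-cancelʳ-≤ (h * h + h * h) _ _ (begin
          2 * (h * h) + (h * h + h * h)                            ≡⟨ sym (quarter (h * h)) ⟩
          4 * (h * h)                                              ≤⟨ *-monoʳ-≤ 4 le′ ⟩
          4 * (hit + (M + (M * f + M * f) + M * (Δ * Δ)))          ≡⟨ expand k h f hit (Δ * Δ) ⟩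
          4 * hit + (8 * k * f * h + 4 * k * (1 + Δ * Δ) * h)      ≤⟨ +-monoʳ-≤ (4 * hit) (+-mono-≤ (*-monoˡ-≤ h (few-full f le)) (*-monoˡ-≤ h big)) ⟩
          4 * hit + (h * h + h * h) ∎)

      module G = Greedy M h Δ D-1 m dense (power-gap D-1 M)

    labelGraph : ∃₂ λ h B → B ≤ h × 1 ≤ h × LabelGraph (k * h) h B
    labelGraph = h , Δ + Δ * Δ , ≤-trans (m≤n+m _ (4 * k * (1 + Δ * Δ))) (n≤1+n _) , s≤s z≤n , sparseLabelGraph h (≤-trans (m≤m+n _ _) (n≤1+n _))
      where
      -- The first summand serves `sparseLabelGraph`, the second gives B ≤ h, and the successor
      -- makes h positive.
      h = suc (4 * k * (1 + Δ * Δ) + (Δ + Δ * Δ))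

  -- The circle graph

  module Circle (b₁ e : ℕ) (e≤b₁ : e ≤ b₁) where

    -- As N - g = e + 1, a difference above `g` is a circular distance of at most e measured across
    -- 0. The hypothesis `e ≤ b₁` means e < b, that is 3e < N.
    b g N : ℕ
    b = suc b₁
    g = b₁ + b
    N = b + b + e

    -- On the circle of circumference N, Near is circular distance ≤ e and Middle is circular
    -- distance ≥ b, i.e. lying in the antipodal window of e + 1 positions.
    Near Middle : ℕ → ℕ → Set
    Near   x y = ∣ x - y ∣ ≤ e ⊎ g < ∣ x - y ∣
    Middle x y = b ≤ ∣ x - y ∣ × ∣ x - y ∣ ≤ b + e

    near? : ∀ x y → Dec (Near x y)
    near? x y = (∣ x - y ∣ ≤? e) ⊎-dec (g <? ∣ x - y ∣)

    middle? : ∀ x y → Dec (Middle x y)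
    middle? x y = (b ≤? ∣ x - y ∣) ×-dec (∣ x - y ∣ ≤? b + e)

    e<g : e < g
    e<g = ≤-trans (s≤s e≤b₁) (m≤n+m b b₁)

    near-sym : ∀ x y → Near x y → Near y x
    near-sym x y rewrite ∣-∣-comm x y = id

    near-refl : ∀ x → Near x x
    near-refl x rewrite ∣n-n∣≡0 x = inj₁ z≤n

    middle-sym : ∀ x y → Middle x y → Middle y x
    middle-sym x y rewrite ∣-∣-comm x y = id

    middle⇒¬near : ∀ x y → Middle x y → ¬ Near x y
    middle⇒¬near x y (b≤ , _) (inj₁ ≤e) = <⇒≱ (s≤s e≤b₁) (≤-trans b≤ ≤e)
    middle⇒¬near x y (_ , ≤b+e) (inj₂ g<) =
      <⇒≱ g< (≤-trans ≤b+e (≤-trans (≤-reflexive (+-comm b e)) (+-monoˡ-≤ b e≤b₁)))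

    private
      split : ∀ x y → x ≡ y + ∣ x - y ∣ ⊎ y ≡ x + ∣ x - y ∣
      split x y with ≤-total x y
      ... | inj₁ x≤y = inj₂ (sym (trans (cong (x +_) (m≤n⇒∣m-n∣≡n∸m x≤y)) (m+[n∸m]≡n x≤y)))
      ... | inj₂ y≤x = inj₁ (sym (trans (cong (y +_) (m≤n⇒∣n-m∣≡n∸m y≤x)) (m+[n∸m]≡n y≤x)))

      window : ∀ {s t} → b ≤ s → s ≤ b + e → b ≤ t → t ≤ b + e → ∣ s - t ∣ ≤ e
      window {s} {t} b≤s s≤ b≤t t≤ with ≤-total s t
      ... | inj₁ s≤t rewrite m≤n⇒∣m-n∣≡n∸m s≤t = m≤n+o⇒m∸n≤o t s (≤-trans t≤ (+-monoˡ-≤ e b≤s))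
      ... | inj₂ t≤s rewrite m≤n⇒∣n-m∣≡n∸m t≤s = m≤n+o⇒m∸n≤o s t (≤-trans s≤ (+-monoˡ-≤ e b≤t))

      opposite : ∀ x y s t → x ≡ y + s + t → b ≤ s → b ≤ t → g < ∣ x - y ∣
      opposite x y s t refl b≤s b≤t rewrite +-assoc y s t | ∣-∣-comm (y + (s + t)) y | ∣m-m+n∣≡n y (s + t) = +-mono-≤ b≤s b≤t

    -- If x and y lie on the same side of z, two numbers in [b, b + e] are subtracted; on opposite
    -- sides they are added, giving at least 2b > g.
    middle-middle⇒near : ∀ x z y → Middle x z → Middle y z → Near x y
    middle-middle⇒near x z y (b≤s , s≤) (b≤t , t≤) with split x z | split y z
    ... | inj₁ x≡ | inj₁ y≡ = inj₁ (subst₂ (λ x y → ∣ x - y ∣ ≤ e) (sym x≡) (sym y≡)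
            (subst (_≤ e) (sym (∣m+n-m+o∣≡∣n-o∣ z _ _)) (window b≤s s≤ b≤t t≤)))
    ... | inj₁ x≡ | inj₂ z≡ = inj₂ (opposite x y _ _ (trans x≡ (cong (_+ ∣ x - z ∣) z≡)) b≤t b≤s)
    ... | inj₂ z≡ | inj₁ y≡ = inj₂ (subst (g <_) (∣-∣-comm y x) (opposite y x _ _ (trans y≡ (cong (_+ ∣ y - z ∣) z≡)) b≤s b≤t))
    ... | inj₂ z≡ | inj₂ z≡′ = inj₁ (subst (_≤ e) (sym same) (window b≤s s≤ b≤t t≤))
      where
      s = ∣ x - z ∣
      t = ∣ y - z ∣
      -- |x - y| = |(x + s + t) - (y + s + t)| with x + s = z = y + t
      same : ∣ x - y ∣ ≡ ∣ s - t ∣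
      same = begin
        ∣ x - y ∣                         ≡⟨ sym (∣m+n-m+o∣≡∣n-o∣ (s + t) x y) ⟩
        ∣ s + t + x - s + t + y ∣         ≡⟨ cong₂ ∣_-_∣ (trans (r₁ s t x) (cong (_+ t) (sym z≡))) (trans (r₂ s t y) (cong (_+ s) (sym z≡′))) ⟩
        ∣ z + t - z + s ∣                 ≡⟨ ∣m+n-m+o∣≡∣n-o∣ z t s ⟩
        ∣ t - s ∣                         ≡⟨ ∣-∣-comm t s ⟩
        ∣ s - t ∣ ∎
        where
        open ≡-Reasoning
        r₁ : ∀ s t x → s + t + x ≡ x + s + t
        r₁ = solve-∀
        r₂ : ∀ s t y → s + t + y ≡ y + t + s
        r₂ = solve-∀

    -- Measured from its least element, a pairwise near set occupies the windows [0, e] and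
    -- (g, g + e].  Sliding the second onto the first is injective, because offsets that collide
    -- differ by g and are not near.
    private
      fold : ℕ → ℕ
      fold t with t ≤? e
      ... | yes _ = t
      ... | no  _ = t ∸ g

      fold≤e : ∀ t → t < N → t ≤ e ⊎ g < t → fold t ≤ e
      fold≤e t t<N c with t ≤? e
      ... | yes t≤e = t≤e
      ... | no  _   = m≤n+o⇒m∸n≤o t g (≤-pred t<N)

      large : ∀ {t} → t ≤ e ⊎ g < t → ¬ t ≤ e → g < t
      large (inj₁ p) q = ⊥-elim (q p)
      large (inj₂ p) q = p

      apart : ∀ t t′ → g < t′ → t ≡ t′ ∸ g → ¬ Near t t′
      apart t t′ g<t′ refl near with subst (λ d → d ≤ e ⊎ g < d) dist near
        where
        dist : ∣ t - t′ ∣ ≡ g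
        dist = trans (m≤n⇒∣m-n∣≡n∸m (m∸n≤m t′ g)) (m∸[m∸n]≡n (<⇒≤ g<t′))
      ... | inj₁ g≤e = <⇒≱ e<g g≤e
      ... | inj₂ g<g = <-irrefl refl g<g

      fold-injective : ∀ t t′ → t ≤ e ⊎ g < t → t′ ≤ e ⊎ g < t′ → Near t t′ → fold t ≡ fold t′ → t ≡ t′
      fold-injective t t′ c c′ near eq with t ≤? e | t′ ≤? e
      ... | yes _  | yes _   = eq
      ... | no t≰e | no t′≰e = ∸-cancelʳ-≡ (<⇒≤ (large c t≰e)) (<⇒≤ (large c′ t′≰e)) eq
      ... | yes _  | no t′≰e = ⊥-elim (apart t t′ (large c′ t′≰e) eq near)
      ... | no t≰e | yes _   = ⊥-elim (apart t′ t (large c t≰e) (sym eq) (near-sym t t′ near))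

    near-clique-≤ : (v : Fin N → ℕ) → (∀ x → v x ≤ 1) →
      (∀ x y → 1 ≤ v x → 1 ≤ v y → Near (toℕ x) (toℕ y)) → sum v ≤ suc e
    near-clique-≤ v v≤1 near with 1 ≤? sum v
    ... | no  Σ≱1 = ≤-trans (≤-pred (≰⇒> Σ≱1)) z≤n
    ... | yes 1≤Σ with x₀ , 1≤v₀ , least ← least-positive-term v 1≤Σ = begin
      sum v                  ≤⟨ sum-transport-≤ v (λ _ → 1) φ v≤1 φ-injective ⟩
      sum {suc e} (λ _ → 1)  ≡⟨ trans (sum-const (suc e) 1) (*-identityʳ _) ⟩
      suc e ∎
      where
      open ≤-Reasoning
      offset : Fin N → ℕ
      offset x = toℕ x ∸ toℕ x₀
      φ : Fin N → Fin (suc e)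
      -- On the set itself `fold` is at most e already; the remainder only makes `φ` total.
      φ x = fold (offset x) mod suc e
      from-x₀ : ∀ x → 1 ≤ v x → toℕ x₀ + offset x ≡ toℕ x
      from-x₀ x 1≤vx = m+[n∸m]≡n (least x 1≤vx)
      zone : ∀ x → 1 ≤ v x → offset x ≤ e ⊎ g < offset x
      zone x 1≤vx = subst (λ d → d ≤ e ⊎ g < d) (m≤n⇒∣n-m∣≡n∸m (least x 1≤vx)) (near x x₀ 1≤vx 1≤v₀)
      toℕ-φ : ∀ x → 1 ≤ v x → toℕ (φ x) ≡ fold (offset x)
      toℕ-φ x 1≤vx = trans (Fin.toℕ-fromℕ< _) (m<n⇒m%n≡m (s≤s
        (fold≤e (offset x) (≤-<-trans (m∸n≤m (toℕ x) (toℕ x₀)) (Fin.toℕ<n x)) (zone x 1≤vx))))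
      φ-injective : ∀ x y → 1 ≤ v x → 1 ≤ v y → φ x ≡ φ y → x ≡ y
      φ-injective x y p q eq = Fin.toℕ-injective (trans (sym (from-x₀ x p)) (trans (cong (toℕ x₀ +_)
        (fold-injective _ _ (zone x p) (zone y q) shifted (trans (sym (toℕ-φ x p)) (trans (cong toℕ eq) (toℕ-φ y q))))) (from-x₀ y q)))
        where
        shifted : Near (offset x) (offset y)
        shifted = subst (λ d → d ≤ e ⊎ g < d) (trans (sym (cong₂ ∣_-_∣ (from-x₀ x p) (from-x₀ y q))) (∣m+n-m+o∣≡∣n-o∣ (toℕ x₀) _ _)) (near x y p q)

    -- The partners are x + b + j for 0 ≤ j ≤ e, reduced by N when necessary; after the reduction
    -- the difference is b + (e - j), again in the window.
    middle-degree : ∀ (x : Fin N) → suc e ≤ sum {N} (λ y → 𝟙 (does (middle? (toℕ x) (toℕ y))))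
    middle-degree x = begin
      suc e                  ≡⟨ sym (trans (sum-const (suc e) 1) (*-identityʳ _)) ⟩
      sum {suc e} (λ _ → 1)  ≤⟨ sum-transport-≤ (λ _ → 1) (λ y → 𝟙 (does (middle? (toℕ x) (toℕ y)))) φ hit φ-injective ⟩
      sum {N} (λ y → 𝟙 (does (middle? (toℕ x) (toℕ y)))) ∎
      where
      open ≤-Reasoning
      X = toℕ x
      record Target (j : Fin (suc e)) : Set where
        field
          y      : Fin N
          middle : Middle X (toℕ y)
          value  : X + (b + toℕ j) ≡ toℕ y ⊎ X + (b + toℕ j) ≡ N + toℕ y
      target : ∀ j → Target j
      target j with X + (b + toℕ j) <? N
      ... | yes lt = record
        { y = fromℕ< lt
        ; middle = subst (Middle X) (sym (Fin.toℕ-fromℕ< lt)) (subst (λ d → b ≤ d × d ≤ b + e) (sym (∣m-m+n∣≡n X (b + toℕ j)))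
                     (m≤m+n b _ , +-monoʳ-≤ b (≤-pred (Fin.toℕ<n j))))
        ; value = inj₁ (sym (Fin.toℕ-fromℕ< lt)) }
      ... | no ≮N = record
        { y = fromℕ< Y<N
        ; middle = subst (Middle X) (sym (Fin.toℕ-fromℕ< Y<N)) (subst (λ d → b ≤ d × d ≤ b + e) (sym dist) bounds)
        ; value = inj₂ (trans wrap (cong (N +_) (sym (Fin.toℕ-fromℕ< Y<N)))) }
        where
        j₁ = toℕ j
        Y = X + (b + j₁) ∸ N
        r = e ∸ j₁
        j₁≤e : j₁ ≤ e
        j₁≤e = ≤-pred (Fin.toℕ<n j)
        wrap : X + (b + j₁) ≡ N + Y
        wrap = sym (m+[n∸m]≡n (≮⇒≥ ≮N))
        X≡ : X ≡ Y + (b + r)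
        X≡ = +-cancelʳ-≡ (b + j₁) X (Y + (b + r)) (trans wrap (trans (cong (λ e → b + b + e + Y) (sym (m∸n+n≡m j₁≤e))) (re b r j₁ Y)))
          where
          re : ∀ b r j₁ Y → b + b + (r + j₁) + Y ≡ Y + (b + r) + (b + j₁)
          re = solve-∀
        dist : ∣ X - Y ∣ ≡ b + r
        dist = trans (cong ∣_- Y ∣ X≡) (trans (∣-∣-comm (Y + (b + r)) Y) (∣m-m+n∣≡n Y (b + r)))
        bounds : b ≤ b + r × b + r ≤ b + e
        bounds = m≤m+n b r , +-monoʳ-≤ b (m∸n≤m e j₁)
        Y<N : Y < N
        Y<N = ≤-<-trans (≤-trans (m≤m+n Y (b + r)) (≤-reflexive (sym X≡))) (Fin.toℕ<n x)
      φ : Fin (suc e) → Fin N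
      φ j = Target.y (target j)
      hit : ∀ j → 1 ≤ 𝟙 (does (middle? X (toℕ (φ j))))
      hit j = ≤-reflexive (sym (cong 𝟙 (dec-true (middle? X (toℕ (φ j))) (Target.middle (target j)))))
      -- Two values of j differ by at most e < N, so a reduced partner never equals an unreduced
      -- one.
      no-wrap : ∀ i j → X + (b + toℕ j) ≢ N + (X + (b + toℕ i))
      no-wrap i j eq = <-irrefl eq (begin-strict
        X + (b + toℕ j)        ≤⟨ +-monoʳ-≤ X (+-monoʳ-≤ b (≤-pred (Fin.toℕ<n j))) ⟩
        X + (b + e)            <⟨ +-monoʳ-< X (+-monoˡ-< e (m<m+n b (s≤s z≤n))) ⟩
        X + N                  ≡⟨ +-comm X N ⟩
        N + X                  ≤⟨ +-monoʳ-≤ N (m≤m+n X _) ⟩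
        N + (X + (b + toℕ i)) ∎)
      φ-injective : ∀ i j → 1 ≤ 1 → 1 ≤ 1 → φ i ≡ φ j → i ≡ j
      φ-injective i j _ _ eq with Target.value (target i) | Target.value (target j)
      ... | inj₁ p | inj₁ q = Fin.toℕ-injective (+-cancelˡ-≡ b _ _ (+-cancelˡ-≡ X _ _ (trans p (trans (cong toℕ eq) (sym q)))))
      ... | inj₂ p | inj₂ q = Fin.toℕ-injective (+-cancelˡ-≡ b _ _ (+-cancelˡ-≡ X _ _ (trans p (trans (cong (λ y → N + toℕ y) eq) (sym q)))))
      ... | inj₁ p | inj₂ q = ⊥-elim (no-wrap i j (trans q (cong (N +_) (sym (trans p (cong toℕ eq))))))
      ... | inj₂ p | inj₁ q = ⊥-elim (no-wrap j i (trans p (cong (N +_) (trans (cong toℕ eq) (sym q)))))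

  -- The finite colouring

  does-true : ∀ {P : Set} {P? : Dec P} → does P? ≡ true → P
  does-true {P? = yes p} _ = p

  exceeds-average : ∀ {n} (f : Fin n → ℕ) c → n * c < sum f → ∃ λ i → c < f i
  exceeds-average {suc n} f c lt with c <? f zero
  ... | yes c<f₀ = zero , c<f₀
  ... | no  c≮f₀ = map suc id (exceeds-average (f ∘ suc) c
    (+-cancelˡ-< c _ _ (<-≤-trans lt (+-monoˡ-≤ _ (≮⇒≥ c≮f₀)))))

  choose : ∀ {n} (f : Fin n → Bool) k → k ≤ sum (𝟙 ∘ f) →
    ∃ λ (φ : Fin k → Fin n) → Injective _≡_ _≡_ φ × (∀ a → f (φ a) ≡ true)
  choose         f zero    _  = (λ ()) , (λ { {()} }) , λ ()
  choose {suc n} f (suc k) le with f zero in eq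
  ... | true with φ , inj , φ-true ← choose (f ∘ suc) k (≤-pred le) =
    (λ { zero → zero ; (suc a) → suc (φ a) }) ,
    (λ { {zero} {zero} _ → refl ; {suc a} {suc b} p → cong suc (inj (Fin.suc-injective p)) }) ,
    (λ { zero → eq ; (suc a) → φ-true a })
  ... | false with φ , inj , φ-true ← choose (f ∘ suc) (suc k) le =
    suc ∘ φ , inj ∘ Fin.suc-injective , φ-true

  module Construction (ℓ₁ b₁ e M h B : ℕ) (e≤b₁ : e ≤ b₁) (L : LabelGraph M h B) .{{M≢0 : NonZero M}} where

    open Circle b₁ e e≤b₁
    open LabelGraph L

    ℓ K : ℕ
    ℓ = suc ℓ₁
    K = ℓ * (N * M)

    -- Part, position on the circle, label. A part and a position together determine a cluster of M
    -- vertices.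
    Vertex : Set
    Vertex = Fin ℓ × Fin N × Fin M

    -- Red pairs are taken between far clusters and purple pairs between linked ones; linked
    -- clusters are far too, by `middle⇒¬near`.
    Far Linked : Fin ℓ → Fin N → Fin ℓ → Fin N → Set
    Far    p x p′ x′ = p ≢ p′ ⊎ ¬ Near (toℕ x) (toℕ x′)
    Linked p x p′ x′ = p ≢ p′ ⊎ Middle (toℕ x) (toℕ x′)

    far? : ∀ p x p′ x′ → Dec (Far p x p′ x′)
    far? p x p′ x′ = ¬? (p ≟F p′) ⊎-dec ¬? (near? (toℕ x) (toℕ x′))

    linked? : ∀ p x p′ x′ → Dec (Linked p x p′ x′)
    linked? p x p′ x′ = ¬? (p ≟F p′) ⊎-dec middle? (toℕ x) (toℕ x′)

    far-sym : ∀ {p x p′ x′} → Far p x p′ x′ → Far p′ x′ p x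
    far-sym          (inj₁ p≢) = inj₁ (p≢ ∘ sym)
    far-sym {x = x} {x′ = x′} (inj₂ ¬n) = inj₂ (¬n ∘ near-sym (toℕ x′) (toℕ x))

    linked-sym : ∀ {p x p′ x′} → Linked p x p′ x′ → Linked p′ x′ p x
    linked-sym          (inj₁ p≢) = inj₁ (p≢ ∘ sym)
    linked-sym {x = x} {x′ = x′} (inj₂ m) = inj₂ (middle-sym (toℕ x) (toℕ x′) m)

    -- Nonzero iff u and v are adjacent or have a common neighbour.
    block : Fin M → Fin M → ℕ
    block u v = 𝟙 (F u v) + codeg F u v

    block-sym : ∀ u v → block u v ≡ block v u
    block-sym u v = cong₂ _+_ (cong 𝟙 (symmetric u v)) (sum-cong-≗ (λ w →
      trans (*-comm (𝟙 (F u w)) _) (cong₂ (λ a b → 𝟙 a * 𝟙 b) (symmetric w v) (symmetric u w))))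

    pick : Bool → Bool → Colour
    pick true  _     = red
    pick false true  = purple
    pick false false = blue

    -- The condition on `block` drops the purple pairs that would close two red ones to a triangle.
    colour : Vertex → Vertex → Colour
    colour (p , x , u) (p′ , x′ , u′) =
      pick (does (far? p x p′ x′) ∧ F u u′) (does (linked? p x p′ x′) ∧ does (block u u′ ≟ 0))

    colour-sym : ∀ v w → colour v w ≡ colour w v
    colour-sym (p , x , u) (p′ , x′ , u′) = cong₂ pick
      (cong₂ _∧_ (does-⇔ (mk⇔ (far-sym {p} {x} {p′} {x′}) (far-sym {p′} {x′} {p} {x})) (far? p x p′ x′) (far? p′ x′ p x)) (symmetric u u′))
      (cong₂ _∧_ (does-⇔ (mk⇔ (linked-sym {p} {x} {p′} {x′}) (linked-sym {p′} {x′} {p} {x})) (linked? p x p′ x′) (linked? p′ x′ p x))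
        (cong (λ t → does (t ≟ 0)) (block-sym u u′)))

    -- In the blow-up this makes every class a blue clique, so the diagonal is neither red nor
    -- counted as purple.
    colour-diagonal : ∀ v → colour v v ≡ blue
    colour-diagonal (p , x , u) = cong₂ pick
      (cong (_∧ F u u) (dec-false (far? p x p x) λ { (inj₁ p≢p) → p≢p refl ; (inj₂ ¬n) → ¬n (near-refl (toℕ x)) }))
      (cong (_∧ does (block u u ≟ 0)) (dec-false (linked? p x p x) λ
        { (inj₁ p≢p) → p≢p refl ; (inj₂ m) → middle⇒¬near (toℕ x) (toℕ x) m (near-refl (toℕ x)) }))

    pick-≢blue : ∀ a b → pick a b ≢ blue → a ≡ true ⊎ b ≡ true
    pick-≢blue true  _     _ = inj₁ refl
    pick-≢blue false true  _ = inj₂ refl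
    pick-≢blue false false ≢ = ⊥-elim (≢ refl)

    far⇒red : ∀ p x u p′ x′ u′ → Far p x p′ x′ → F u u′ ≡ true → colour (p , x , u) (p′ , x′ , u′) ≡ red
    far⇒red p x u p′ x′ u′ far eq rewrite dec-true (far? p x p′ x′) far | eq = refl

    -- If `block` vanishes, the labels are not adjacent, so the red test, which has priority in
    -- `pick`, fails.
    purple-indicator : ∀ p x u p′ x′ u′ →
      𝟙 (does (linked? p x p′ x′)) * 𝟙 (does (block u u′ ≟ 0)) ≤ 𝟙 (isPurple (colour (p , x , u) (p′ , x′ , u′)))
    purple-indicator p x u p′ x′ u′ = go (does (far? p x p′ x′)) (F u u′) (does (linked? p x p′ x′)) (codeg F u u′)
      where
      go : ∀ a f l c → 𝟙 l * 𝟙 (does (𝟙 f + c ≟ 0)) ≤ 𝟙 (isPurple (pick (a ∧ f) (l ∧ does (𝟙 f + c ≟ 0))))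
      go a     true  l     c = ≤-trans (≤-reflexive (*-zeroʳ (𝟙 l))) z≤n
      go true  false false c = z≤n
      go true  false true  zero    = ≤-refl
      go true  false true  (suc c) = z≤n
      go false false false c = z≤n
      go false false true  zero    = ≤-refl
      go false false true  (suc c) = z≤n

    path⇒blocked : ∀ {u w v} → F u w ≡ true → F w v ≡ true → block u v ≢ 0
    path⇒blocked {u} {w} {v} p q block≡0 =
      <⇒≱ (≤-trans (1≤codeg F p q) (m≤n+m _ (𝟙 (F u v)))) (≤-reflexive block≡0)

    -- Within one part, the first alternative is a red pair and the second a purple one.
    Edge : Fin N → Fin M → Fin N → Fin M → Set
    Edge x u x′ u′ = (¬ Near (toℕ x) (toℕ x′) × F u u′ ≡ true) ⊎ (Middle (toℕ x) (toℕ x′) × block u u′ ≡ 0)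

    same-part-edge : ∀ p x u x′ u′ → colour (p , x , u) (p , x′ , u′) ≢ blue → Edge x u x′ u′
    same-part-edge p x u x′ u′ ≢blue with pick-≢blue _ _ ≢blue
    ... | inj₁ r with ∧-true r
    ...   | far , f with does-true {P? = far? p x p x′} far
    ...     | inj₁ p≢p = ⊥-elim (p≢p refl)
    ...     | inj₂ ¬n  = inj₁ (¬n , f)
    same-part-edge p x u x′ u′ ≢blue | inj₂ r with ∧-true r
    ...   | lk , b with does-true {P? = linked? p x p x′} lk
    ...     | inj₁ p≢p = ⊥-elim (p≢p refl)
    ...     | inj₂ m   = inj₂ (m , does-true {P? = block u u′ ≟ 0} b)

    edge-not-near : ∀ x {u} x′ {u′} → Edge x u x′ u′ → ¬ Near (toℕ x) (toℕ x′)
    edge-not-near x x′ (inj₁ (¬n , _)) = ¬n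
    edge-not-near x x′ (inj₂ (m , _)) = middle⇒¬near (toℕ x) (toℕ x′) m

    -- Two purple sides bring the ends of the third too near. One purple side over two red ones is
    -- excluded by `block`, and three red sides give a triangle of labels.
    part-triangle-free : ∀ {x₁ u₁ x₂ u₂ x₃ u₃} → Edge x₁ u₁ x₂ u₂ → Edge x₂ u₂ x₃ u₃ → Edge x₁ u₁ x₃ u₃ → ⊥
    part-triangle-free {x₁} {u₁} {x₂} {u₂} {x₃} {u₃} e₁₂ e₂₃ e₁₃ with e₁₂ | e₂₃ | e₁₃
    ... | inj₂ (m₁₂ , _) | inj₂ (m₂₃ , _) | _ =
      edge-not-near x₁ x₃ e₁₃ (middle-middle⇒near (toℕ x₁) (toℕ x₂) (toℕ x₃) m₁₂ (middle-sym (toℕ x₂) (toℕ x₃) m₂₃))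
    ... | inj₂ (m₁₂ , _) | inj₁ _ | inj₂ (m₁₃ , _) =
      edge-not-near x₂ x₃ e₂₃ (middle-middle⇒near (toℕ x₂) (toℕ x₁) (toℕ x₃) (middle-sym (toℕ x₁) (toℕ x₂) m₁₂) (middle-sym (toℕ x₁) (toℕ x₃) m₁₃))
    ... | inj₁ _ | inj₂ (m₂₃ , _) | inj₂ (m₁₃ , _) =
      edge-not-near x₁ x₂ e₁₂ (middle-middle⇒near (toℕ x₁) (toℕ x₃) (toℕ x₂) m₁₃ m₂₃)
    ... | inj₁ (_ , f₁₂) | inj₁ (_ , f₂₃) | inj₁ (_ , f₁₃) = triangleFree u₁ u₂ u₃ f₁₂ f₂₃ f₁₃
    ... | inj₁ (_ , f₁₂) | inj₁ (_ , f₂₃) | inj₂ (_ , b₁₃) = path⇒blocked f₁₂ f₂₃ b₁₃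
    ... | inj₁ (_ , f₁₂) | inj₂ (_ , b₂₃) | inj₁ (_ , f₁₃) = path⇒blocked (trans (symmetric u₂ u₁) f₁₂) f₁₃ b₂₃
    ... | inj₂ (_ , b₁₂) | inj₁ (_ , f₂₃) | inj₁ (_ , f₁₃) = path⇒blocked f₁₃ (trans (symmetric u₃ u₂) f₂₃) b₁₂

    -- Independent sets of red and the number of purple pairs

    encode : Vertex → Fin K
    encode (p , x , u) = combine p (combine x u)

    decode : Fin K → Vertex
    decode k = map₂ (remQuot M) (remQuot (N * M) k)

    decode-encode : ∀ v → decode (encode v) ≡ v
    decode-encode (p , x , u) = trans (cong (map₂ (remQuot M)) (Fin.remQuot-combine p (combine x u)))
      (cong (p ,_) (Fin.remQuot-combine x u))

    sum-vertices : ∀ (f : Fin K → ℕ) → sum f ≡ sum (λ p → sum (λ x → sum (λ u → f (encode (p , x , u)))))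
    sum-vertices f = trans (sum-combine ℓ (N * M) f) (sum-cong-≗ {ℓ} (λ p → sum-combine N M (λ r → f (combine {ℓ} p r))))

    instance
      K≢0 : NonZero K
      K≢0 = m*n≢0 ℓ (N * M) {{_}} {{m*n≢0 N M}}

    module _ (J : Fin K → Bool) (no-red : ∀ v w → J (encode v) ≡ true → J (encode w) ≡ true → colour v w ≢ red) where

      slice : Fin ℓ → Fin N → Fin M → Bool
      slice p x u = J (encode (p , x , u))

      -- The threshold h is the size from which `holeFree` applies to the labels of `J` in a
      -- cluster.
      weight heavy : Fin ℓ → Fin N → ℕ
      weight p x = sum (𝟙 ∘ slice p x)
      heavy  p x = 𝟙 (does (h ≤? weight p x))

      heavy⇒ : ∀ {p x} → 1 ≤ heavy p x → h ≤ weight p x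
      heavy⇒ {p} {x} le = does-true {P? = h ≤? weight p x} (𝟙-true le)

      weight≤ : ∀ p x → weight p x ≤ h + heavy p x * M
      weight≤ p x = go (h ≤? weight p x)
        where
        weight≤M : weight p x ≤ M
        weight≤M = ≤-trans (sum-mono-≤ (λ u → 𝟙≤1 (slice p x u))) (≤-reflexive (trans (sum-const M 1) (*-identityʳ M)))
        go : (d : Dec (h ≤ weight p x)) → weight p x ≤ h + 𝟙 (does d) * M
        go (yes _) = ≤-trans weight≤M (≤-trans (≤-reflexive (sym (*-identityˡ M))) (m≤n+m _ h))
        go (no ≰h) = ≤-trans (<⇒≤ (≰⇒> ≰h)) (m≤m+n h _)

      heavy-pair : ∀ p x p′ x′ → 1 ≤ heavy p x → 1 ≤ heavy p′ x′ → ¬ Far p x p′ x′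
      heavy-pair p x p′ x′ hv hv′ far with holeFree (slice p x) (slice p′ x′) (heavy⇒ {p} {x} hv) (heavy⇒ {p′} {x′} hv′)
      ... | u , u′ , j , j′ , f = no-red (p , x , u) (p′ , x′ , u′) j j′ (far⇒red p x u p′ x′ u′ far f)

      -- Two heavy clusters are never far, so all of them lie in one part, at pairwise near
      -- positions.
      heavy-sum : sum (λ p → sum (heavy p)) ≤ suc e
      heavy-sum = ≤-trans (≤-reflexive (∑-comm heavy)) (near-clique-≤ (λ x → sum (λ p → heavy p x))
        (λ x → sum≤single _ 1 (λ p → 𝟙≤1 _) (λ p p′ q q′ → same-part p x p′ x q q′))
        (λ x x′ q q′ → let p , r = positive-term (λ p → heavy p x) q ; p′ , r′ = positive-term (λ p → heavy p x′) q′
                       in same-position p x p′ x′ r r′))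
        where
        same-part : ∀ p x p′ x′ → 1 ≤ heavy p x → 1 ≤ heavy p′ x′ → p ≡ p′
        same-part p x p′ x′ q q′ = decidable-stable (p ≟F p′) (heavy-pair p x p′ x′ q q′ ∘ inj₁)
        same-position : ∀ p x p′ x′ → 1 ≤ heavy p x → 1 ≤ heavy p′ x′ → Near (toℕ x) (toℕ x′)
        same-position p x p′ x′ q q′ = decidable-stable (near? (toℕ x) (toℕ x′)) (heavy-pair p x p′ x′ q q′ ∘ inj₂)

      -- Every cluster is charged h, and each of the at most e + 1 heavy ones M more.
      independent-≤ : sum (𝟙 ∘ J) ≤ ℓ * (N * h) + suc e * M
      independent-≤ = begin
        sum (𝟙 ∘ J)                                                      ≡⟨ sum-vertices (𝟙 ∘ J) ⟩
        sum (λ p → sum (λ x → weight p x))                               ≤⟨ sum-mono-≤ (λ p → sum-mono-≤ (weight≤ p)) ⟩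
        sum (λ p → sum (λ x → h + heavy p x * M))
          ≡⟨ trans (sum-cong-≗ (λ p → trans (∑-distrib-+ {N} (λ _ → h) (λ x → heavy p x * M)) (cong₂ _+_ (sum-const N h) (sym (*-distribʳ-sum M (heavy p))))))
               (trans (∑-distrib-+ {ℓ} (λ _ → N * h) (λ p → sum (heavy p) * M)) (cong₂ _+_ (sum-const ℓ (N * h)) (sym (*-distribʳ-sum M (λ p → sum (heavy p)))))) ⟩
        ℓ * (N * h) + sum (λ p → sum (heavy p)) * M                      ≤⟨ +-monoʳ-≤ (ℓ * (N * h)) (*-monoˡ-≤ M heavy-sum) ⟩
        ℓ * (N * h) + suc e * M ∎
        where open ≤-Reasoning

    degree : ℕ
    degree = suc e + ℓ₁ * N

    -- There are at least e + 1 antipodal positions in the own part, and all N positions in each of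
    -- the ℓ₁ other parts.
    linked-count : ∀ p x → degree ≤ sum (λ p′ → sum (λ x′ → 𝟙 (does (linked? p x p′ x′))))
    linked-count p x = begin
      suc e + ℓ₁ * N                      ≡⟨ cong (suc e +_) (sym (sum-const ℓ₁ N)) ⟩
      suc e + sum {ℓ₁} (λ _ → N)          ≤⟨ +-mono-≤ own (sum-mono-≤ (λ j → ≤-reflexive (sym (other (punchIn p j) (Fin.punchInᵢ≢i p j ∘ sym))))) ⟩
      row p + sum (removeAt row p)        ≡⟨ sym (sum-remove {i = p} row) ⟩
      sum row ∎
      where
      open ≤-Reasoning
      row : Fin ℓ → ℕ
      row p′ = sum (λ x′ → 𝟙 (does (linked? p x p′ x′)))
      own : suc e ≤ row p
      own = ≤-trans (middle-degree x) (sum-mono-≤ {N} (λ x′ → go (middle? (toℕ x) (toℕ x′)) (linked? p x p x′)))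
        where
        go : ∀ {x′} (d : Dec (Middle (toℕ x) (toℕ x′))) (d′ : Dec (Linked p x p x′)) → 𝟙 (does d) ≤ 𝟙 (does d′)
        go (no _)  _        = z≤n
        go (yes _) (yes _)  = ≤-refl
        go (yes m) (no ¬lk) = ⊥-elim (¬lk (inj₂ m))
      other : ∀ p′ → p ≢ p′ → row p′ ≡ N
      other p′ p≢p′ = trans (sum-cong-≗ {N} (λ x′ → cong 𝟙 (dec-true (linked? p x p′ x′) (inj₁ p≢p′))))
        (trans (sum-const N 1) (*-identityʳ N))

    purpleᴷ : Fin K → Fin K → ℕ
    purpleᴷ a b = 𝟙 (isPurple (colour (decode a) (decode b)))

    unblocked : Fin M → ℕ
    unblocked u = sum (λ u′ → 𝟙 (does (block u u′ ≟ 0)))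

    M≤unblocked+B : ∀ u → M ≤ unblocked u + B
    M≤unblocked+B u = begin
      M                                                          ≡⟨ sym (trans (sum-const M 1) (*-identityʳ M)) ⟩
      sum {M} (λ _ → 1)                                          ≤⟨ sum-mono-≤ (λ u′ → go (block u u′)) ⟩
      sum (λ u′ → 𝟙 (does (block u u′ ≟ 0)) + block u u′)        ≡⟨ ∑-distrib-+ (λ u′ → 𝟙 (does (block u u′ ≟ 0))) (block u) ⟩
      unblocked u + sum (block u)                                ≤⟨ +-monoʳ-≤ (unblocked u) (sparse u) ⟩
      unblocked u + B ∎
      where
      open ≤-Reasoning
      go : ∀ t → 1 ≤ 𝟙 (does (t ≟ 0)) + t
      go zero    = s≤s z≤n
      go (suc t) = s≤s z≤n

    -- In each linked cluster all but at most B labels are unblocked and hence purple.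
    purple-degree : ∀ v → degree * M ≤ sum (λ b → 𝟙 (isPurple (colour v (decode b)))) + degree * B
    purple-degree (p , x , u) = begin
      degree * M                              ≤⟨ *-monoʳ-≤ degree (M≤unblocked+B u) ⟩
      degree * (unblocked u + B)              ≡⟨ *-distribˡ-+ degree (unblocked u) B ⟩
      degree * unblocked u + degree * B       ≤⟨ +-monoˡ-≤ (degree * B) inner ⟩
      sum (λ b → 𝟙 (isPurple (colour (p , x , u) (decode b)))) + degree * B ∎
      where
      open ≤-Reasoning
      inner : degree * unblocked u ≤ sum (λ b → 𝟙 (isPurple (colour (p , x , u) (decode b))))
      inner = begin
        degree * unblocked u
          ≤⟨ *-monoˡ-≤ (unblocked u) (linked-count p x) ⟩
        sum (λ p′ → sum (λ x′ → 𝟙 (does (linked? p x p′ x′)))) * unblocked u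
          ≡⟨ trans (*-distribʳ-sum (unblocked u) (λ p′ → sum (λ x′ → 𝟙 (does (linked? p x p′ x′)))))
               (sum-cong-≗ (λ p′ → trans (*-distribʳ-sum (unblocked u) (λ x′ → 𝟙 (does (linked? p x p′ x′))))
                 (sum-cong-≗ {N} (λ x′ → *-distribˡ-sum (𝟙 (does (linked? p x p′ x′))) (λ u′ → 𝟙 (does (block u u′ ≟ 0))))))) ⟩
        sum (λ p′ → sum (λ x′ → sum (λ u′ → 𝟙 (does (linked? p x p′ x′)) * 𝟙 (does (block u u′ ≟ 0)))))
          ≤⟨ sum-mono-≤ (λ p′ → sum-mono-≤ (λ x′ → sum-mono-≤ (λ u′ → purple-indicator p x u p′ x′ u′))) ⟩
        sum (λ p′ → sum (λ x′ → sum (λ u′ → 𝟙 (isPurple (colour (p , x , u) (p′ , x′ , u′))))))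
          ≡⟨ sum-cong-≗ (λ p′ → sum-cong-≗ (λ x′ → sum-cong-≗ (λ u′ → cong (λ w → 𝟙 (isPurple (colour (p , x , u) w))) (sym (decode-encode (p′ , x′ , u′)))))) ⟩
        sum (λ p′ → sum (λ x′ → sum (λ u′ → 𝟙 (isPurple (colour (p , x , u) (decode (encode (p′ , x′ , u′))))))))
          ≡⟨ sym (sum-vertices (λ b → 𝟙 (isPurple (colour (p , x , u) (decode b))))) ⟩
        sum (λ b → 𝟙 (isPurple (colour (p , x , u) (decode b)))) ∎

    purple-total : K * (degree * M) ≤ sum (λ a → sum (purpleᴷ a)) + K * (degree * B)
    purple-total = begin
      K * (degree * M)                                     ≡⟨ sym (sum-const K (degree * M)) ⟩
      sum {K} (λ _ → degree * M)                           ≤⟨ sum-mono-≤ (purple-degree ∘ decode) ⟩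
      sum (λ a → sum (purpleᴷ a) + degree * B)             ≡⟨ trans (∑-distrib-+ (λ a → sum (purpleᴷ a)) _) (cong (sum (λ a → sum (purpleᴷ a)) +_) (sum-const K (degree * B))) ⟩
      sum (λ a → sum (purpleᴷ a)) + K * (degree * B) ∎
      where open ≤-Reasoning

  -- The blow-up

  <ᵇ-true : ∀ {m n} → m < n → (m <ᵇ n) ≡ true
  <ᵇ-true lt = Equivalence.to T-≡ (<⇒<ᵇ lt)

  -- A purple ordered pair is off the diagonal, so it or its reverse is increasing and counted.
  double-purpleCount : ∀ {n} (col : Colouring n) → IsSymmetric col → (∀ i → col i i ≡ blue) →
    sum (λ i → sum (λ j → 𝟙 (isPurple (col i j)))) ≤ 2 * purpleCount col
  double-purpleCount {n} col sym-col diag = begin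
    sum (λ i → sum (λ j → 𝟙 (isPurple (col i j))))                ≤⟨ sum-mono-≤ (λ i → sum-mono-≤ (λ j → term i j)) ⟩
    sum (λ i → sum (λ j → ord i j + ord j i))                     ≡⟨ sum-cong-≗ (λ i → ∑-distrib-+ (ord i) (λ j → ord j i)) ⟩
    sum (λ i → sum (ord i) + sum (λ j → ord j i))                 ≡⟨ ∑-distrib-+ (λ i → sum (ord i)) _ ⟩
    sum (λ i → sum (ord i)) + sum (λ i → sum (λ j → ord j i))     ≡⟨ cong (sum (λ i → sum (ord i)) +_) (∑-comm (λ i j → ord j i)) ⟩
    sum (λ i → sum (ord i)) + sum (λ i → sum (ord i))             ≡⟨ cong₂ _+_ count (trans count (sym (+-identityʳ _))) ⟩
    2 * purpleCount col ∎
    where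
    open ≤-Reasoning
    ord : Fin n → Fin n → ℕ
    ord i j = 𝟙 ((toℕ i <ᵇ toℕ j) ∧ isPurple (col i j))
    count : sum (λ i → sum (ord i)) ≡ purpleCount col
    count = sym (trans (sum-allFin {n} (λ i → sumᴸ (List.map (ord i) (allFin n)))) (sum-cong-≗ (λ i → sum-allFin (ord i))))
    term : ∀ i j → 𝟙 (isPurple (col i j)) ≤ ord i j + ord j i
    term i j with <-cmp (toℕ i) (toℕ j)
    ... | tri< i<j _ _ rewrite <ᵇ-true i<j = m≤m+n _ _
    ... | tri> _ _ j<i rewrite <ᵇ-true j<i | sym-col i j = m≤n+m _ _
    ... | tri≈ _ i≡j _ rewrite Fin.toℕ-injective i≡j | diag j = z≤n

  module Blowup (ℓ₁ b₁ e M h B : ℕ) (e≤b₁ : e ≤ b₁) (L : LabelGraph M h B) .{{M≢0 : NonZero M}} (n : ℕ) where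

    open Circle b₁ e e≤b₁
    open Construction ℓ₁ b₁ e M h B e≤b₁ L

    class : Fin n → Fin K
    class i = toℕ i mod K

    vertex : Fin n → Vertex
    vertex = decode ∘ class

    col : Colouring n
    col i j = colour (vertex i) (vertex j)

    col-symmetric : IsSymmetric col
    col-symmetric i j = colour-sym (vertex i) (vertex j)

    no-triangle-in-part : ∀ v₁ v₂ v₃ {p} → proj₁ v₁ ≡ p → proj₁ v₂ ≡ p → proj₁ v₃ ≡ p →
      colour v₁ v₂ ≢ blue → colour v₂ v₃ ≢ blue → colour v₁ v₃ ≢ blue → ⊥
    no-triangle-in-part (p , x₁ , u₁) (_ , x₂ , u₂) (_ , x₃ , u₃) refl refl refl c₁₂ c₂₃ c₁₃ =
      part-triangle-free {x₁} {u₁} {x₂} {u₂} {x₃} {u₃}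
        (same-part-edge p x₁ u₁ x₂ u₂ c₁₂) (same-part-edge p x₂ u₂ x₃ u₃ c₂₃) (same-part-edge p x₁ u₁ x₃ u₃ c₁₃)

    -- By pigeonhole, three of 2ℓ + 1 vertices share one of the ℓ parts.
    redOrPurple-free : KFree (suc (2 * ℓ)) (RedOrPurple col)
    redOrPurple-free (f , _ , adj) with exceeds-average count 2 crowded
      where
      count : Fin ℓ → ℕ
      count p = sum (λ a → δ (proj₁ (vertex (f a))) p)
      crowded : ℓ * 2 < sum count
      crowded = begin-strict
        ℓ * 2                                                        ≡⟨ *-comm ℓ 2 ⟩
        2 * ℓ                                                        <⟨ n<1+n (2 * ℓ) ⟩
        suc (2 * ℓ)                                                  ≡⟨ sym (trans (sum-const (suc (2 * ℓ)) 1) (*-identityʳ _)) ⟩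
        sum {suc (2 * ℓ)} (λ _ → 1)
          ≤⟨ sum-mono-≤ {suc (2 * ℓ)} (λ a → ≤-trans (≤-reflexive (sym (δ-refl (proj₁ (vertex (f a)))))) (term≤sum (λ p → δ (proj₁ (vertex (f a))) p) _)) ⟩
        sum {suc (2 * ℓ)} (λ a → sum (λ p → δ (proj₁ (vertex (f a))) p)) ≡⟨ ∑-comm {suc (2 * ℓ)} (λ a p → δ (proj₁ (vertex (f a))) p) ⟩
        sum count ∎
        where open ≤-Reasoning
    ... | p , 3≤ with choose (λ a → does (proj₁ (vertex (f a)) ≟F p)) 3 3≤
    ...   | φ , inj , φ-true = no-triangle-in-part (at 0F) (at 1F) (at 2F) (in-p 0F) (in-p 1F) (in-p 2F)
      (adj (φ 0F) (φ 1F) ((λ ()) ∘ inj)) (adj (φ 1F) (φ 2F) ((λ ()) ∘ inj)) (adj (φ 0F) (φ 2F) ((λ ()) ∘ inj))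
      where
      at : Fin 3 → Vertex
      at i = vertex (f (φ i))
      in-p : ∀ i → proj₁ (at i) ≡ p
      in-p i = does-true {P? = proj₁ (at i) ≟F p} (φ-true i)

    n≤ : n ≤ suc (n / K) * K
    n≤ = ≤-trans (≤-reflexive (m≡m%n+[m/n]*n n K)) (+-monoˡ-≤ (n / K * K) (m%n≤n n K))

    -- The classes met by the clique contain no red pair, so `independent-≤` bounds their number;
    -- each class has at most n / K + 1 vertices.
    blueOrPurple-clique-≤ : ∀ {t} → ContainsK t (BlueOrPurple col) → t ≤ suc (n / K) * (ℓ * (N * h) + suc e * M)
    blueOrPurple-clique-≤ {t} (f , inj , adj) = begin
      t                                             ≡⟨ sym (trans (sum-const t 1) (*-identityʳ t)) ⟩
      sum {t} (λ _ → 1)                             ≤⟨ sum-transport-≤ (λ _ → 1) (λ i → 𝟙 (J (class i))) f (λ a → ≤-reflexive (sym (cong 𝟙 (member a)))) (λ a b _ _ → inj) ⟩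
      sum {n} (λ i → 𝟙 (J (class i)))               ≤⟨ sumℕ-monoˡ-≤ (λ i → 𝟙 (J (i mod K))) n≤ ⟩
      sumℕ (suc (n / K) * K) (λ i → 𝟙 (J (i mod K))) ≡⟨ sum-mod K (𝟙 ∘ J) (suc (n / K)) ⟩
      suc (n / K) * sum (𝟙 ∘ J)                     ≤⟨ *-monoʳ-≤ (suc (n / K)) (independent-≤ J no-red) ⟩
      suc (n / K) * (ℓ * (N * h) + suc e * M) ∎
      where
      open ≤-Reasoning
      J? : ∀ k → Dec (∃ λ a → class (f a) ≡ k)
      J? k = Fin.any? (λ a → class (f a) ≟F k)
      J : Fin K → Bool
      J k = does (J? k)
      member : ∀ a → J (class (f a)) ≡ true
      member a = dec-true (J? (class (f a))) (a , refl)
      vertex≡ : ∀ v {a} → class (f a) ≡ encode v → vertex (f a) ≡ v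
      vertex≡ v eq = trans (cong decode eq) (decode-encode v)
      no-red : ∀ v w → J (encode v) ≡ true → J (encode w) ≡ true → colour v w ≢ red
      no-red v w jv jw with does-true {P? = J? (encode v)} jv | does-true {P? = J? (encode w)} jw
      ... | a , eqa | b , eqb with a ≟F b
      ...   | no a≢b = subst₂ (λ v w → colour v w ≢ red) (vertex≡ v eqa) (vertex≡ w eqb) (adj a b a≢b)
      -- One clique vertex witnesses both classes, so v = w and the pair is blue.
      ...   | yes refl = λ eq → case-blue (trans (sym (colour-diagonal v)) (trans (cong (colour v) (trans (sym (vertex≡ v eqa)) (vertex≡ w eqb))) eq))
        where
        case-blue : blue ≢ red
        case-blue ()

    -- Every class has at least n / K vertices, so a purple pair of classes yields at least (n / K)²
    -- purple pairs.
    purpleCount-≥ : (n / K) * ((n / K) * sum (λ a → sum (purpleᴷ a))) ≤ 2 * purpleCount col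
    purpleCount-≥ = begin
      q * (q * sum (λ a → sum (purpleᴷ a)))                       ≡⟨ cong (q *_) (*-distribˡ-sum q (λ a → sum (purpleᴷ a))) ⟩
      q * sum (λ a → q * sum (purpleᴷ a))                         ≤⟨ *-monoʳ-≤ q (sum-mono-≤ (λ a → copies (purpleᴷ a))) ⟩
      q * sum (λ a → sum (λ j → purpleᴷ a (class j)))             ≤⟨ copies (λ a → sum (λ j → purpleᴷ a (class j))) ⟩
      sum (λ i → sum (λ j → purpleᴷ (class i) (class j)))         ≤⟨ double-purpleCount col col-symmetric (λ i → colour-diagonal (vertex i)) ⟩
      2 * purpleCount col ∎
      where
      open ≤-Reasoning
      q = n / K
      copies : ∀ (g : Fin K → ℕ) → q * sum g ≤ sum (g ∘ class)
      copies g = ≤-trans (≤-reflexive (sym (sum-mod K g q))) (sumℕ-monoˡ-≤ (λ i → g (i mod K)) (m/n*n≤m n K))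

  -- Choice of the parameters

  -- With c = u / v, the equation says α = cK - M / 2. From cqK ≤ cn ≤ t ≤ (q + 1) α follows (q + 1)
  -- M / 2 ≤ cK, which fails once q ≥ 2uK.
  clique-too-large : ∀ u v t n q K M α → 1 ≤ v * M → q * K ≤ n → 2 * u * K ≤ q → 2 * v * α + v * M ≡ 2 * u * K →
    t ≤ suc q * α → u * n ≤ t * v → ⊥
  clique-too-large u v t n q K M α 1≤vM qK≤n 2uK≤q eq t≤ un≤tv = <⇒≱ (s≤s 2uK≤q) (begin
    suc q                     ≡⟨ sym (*-identityʳ (suc q)) ⟩
    suc q * 1                 ≤⟨ *-monoʳ-≤ (suc q) 1≤vM ⟩
    suc q * (v * M)           ≤⟨ +-cancelˡ-≤ (2 * (u * (q * K))) _ _ (begin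
      2 * (u * (q * K)) + suc q * (v * M)   ≤⟨ +-monoˡ-≤ _ (*-monoʳ-≤ 2 (≤-trans (*-monoʳ-≤ u qK≤n) un≤tv)) ⟩
      2 * (t * v) + suc q * (v * M)         ≤⟨ +-monoˡ-≤ _ (*-monoʳ-≤ 2 (*-monoˡ-≤ v t≤)) ⟩
      2 * (suc q * α * v) + suc q * (v * M) ≡⟨ r₁ (suc q) α v M ⟩
      suc q * (2 * v * α + v * M)           ≡⟨ cong (suc q *_) eq ⟩
      suc q * (2 * u * K)                   ≡⟨ r₂ q u K ⟩
      2 * (u * (q * K)) + 2 * u * K ∎) ⟩
    2 * u * K ∎)
    where
    open ≤-Reasoning
    r₁ : ∀ q α v M → 2 * (q * α * v) + q * (v * M) ≡ q * (2 * v * α + v * M)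
    r₁ = solve-∀
    r₂ : ∀ q u K → (1 + q) * (2 * u * K) ≡ 2 * (u * (q * K)) + 2 * u * K
    r₂ = solve-∀

  -- The difference of squares is (n - qK)(n + qK), with factors at most K and 2n.
  square-≤ : ∀ n q K → q * K ≤ n → n ≤ suc q * K → n * n ≤ q * K * (q * K) + 2 * K * n
  square-≤ n q K qK≤n n≤ = begin
    n * n                                  ≤⟨ *-monoˡ-≤ n n≤ ⟩
    (K + q * K) * n                        ≡⟨ *-distribʳ-+ n K (q * K) ⟩
    K * n + q * K * n                      ≤⟨ +-monoʳ-≤ (K * n) (*-monoʳ-≤ (q * K) n≤) ⟩
    K * n + q * K * (K + q * K)            ≡⟨ r₁ n q K ⟩
    q * K * (q * K) + (K * n + K * (q * K)) ≤⟨ +-monoʳ-≤ (q * K * (q * K)) (+-monoʳ-≤ (K * n) (*-monoʳ-≤ K qK≤n)) ⟩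
    q * K * (q * K) + (K * n + K * n)      ≡⟨ r₂ n q K ⟩
    q * K * (q * K) + 2 * K * n ∎
    where
    open ≤-Reasoning
    r₁ : ∀ n q K → K * n + q * K * (K + q * K) ≡ q * K * (q * K) + (K * n + K * (q * K))
    r₁ = solve-∀
    r₂ : ∀ n q K → q * K * (q * K) + (K * n + K * n) ≡ q * K * (q * K) + 2 * K * n
    r₂ = solve-∀

  -- After multiplication by 2, the error in `base` and the rounding of n to a multiple of K cost at
  -- most n² each, which 2 s n² covers.
  blow-up-count : ∀ w A s P pc n q K → 1 ≤ s → q * K ≤ n → n ≤ suc q * K → 4 * w * A * K ≤ n →
    2 * w * A * (K * K) ≤ 2 * w * s * P + K * K → q * (q * P) ≤ 2 * pc →
    w * A * (n * n) ≤ 2 * s * w * pc + s * (n * n)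
  blow-up-count w A s P pc n q K 1≤s qK≤n n≤ large base count = *-cancelˡ-≤ 2 (begin
    2 * (w * A * (n * n))                                      ≡⟨ r₀ w A (n * n) ⟩
    2 * w * A * (n * n)                                        ≤⟨ *-monoʳ-≤ (2 * w * A) (square-≤ n q K qK≤n n≤) ⟩
    2 * w * A * (q * K * (q * K) + 2 * K * n)                  ≡⟨ r₁ w A q K n ⟩
    q * q * (2 * w * A * (K * K)) + 4 * w * A * K * n          ≤⟨ +-mono-≤ (*-monoʳ-≤ (q * q) base) (*-monoˡ-≤ n large) ⟩
    q * q * (2 * w * s * P + K * K) + n * n                    ≡⟨ r₂ w s q K P n ⟩
    2 * w * s * (q * (q * P)) + (q * K * (q * K) + n * n)      ≤⟨ +-mono-≤ (*-monoʳ-≤ (2 * w * s) count) (+-monoˡ-≤ (n * n) (*-mono-≤ qK≤n qK≤n)) ⟩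
    2 * w * s * (2 * pc) + (n * n + n * n)                     ≡⟨ r₃ w s pc (n * n) ⟩
    2 * (2 * s * w * pc + 1 * (n * n))                         ≤⟨ *-monoʳ-≤ 2 (+-monoʳ-≤ (2 * s * w * pc) (*-monoˡ-≤ (n * n) 1≤s)) ⟩
    2 * (2 * s * w * pc + s * (n * n)) ∎)
    where
    open ≤-Reasoning
    r₀ : ∀ w A m → 2 * (w * A * m) ≡ 2 * w * A * m
    r₀ = solve-∀
    r₁ : ∀ w A q K n → 2 * w * A * (q * K * (q * K) + 2 * K * n) ≡ q * q * (2 * w * A * (K * K)) + 4 * w * A * K * n
    r₁ = solve-∀
    r₂ : ∀ w s q K P n → q * q * (2 * w * s * P + K * K) + n * n ≡ 2 * w * s * (q * (q * P)) + (q * K * (q * K) + n * n)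
    r₂ = solve-∀
    r₃ : ∀ w s pc m → 2 * w * s * (2 * pc) + (m + m) ≡ 2 * (2 * s * w * pc + 1 * m)
    r₃ = solve-∀

  -- N is the circumference of the circle and e + 2 = cℓN, so that an independent set of e + 1
  -- full clusters leaves room for M / 2 more vertices, enough for all the light clusters.
  module Density (ℓ₁ u v w b₁ e M h B : ℕ) (e≤b₁ : e ≤ b₁) (L : LabelGraph M h B) .{{M≢0 : NonZero M}}
    (N≡ : suc b₁ + suc b₁ + e ≡ 2 * (v * (2 * w)))
    (e+2≡ : suc e + 1 ≡ 2 * (suc ℓ₁ * u * (2 * w)))
    (M≡ : M ≡ 2 * (suc ℓ₁ * (suc b₁ + suc b₁ + e)) * h)
    (B≤h : B ≤ h) (1≤v : 1 ≤ v) where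

    open Construction ℓ₁ b₁ e M h B e≤b₁ L using (K; K≢0; degree; purple-total; purpleᴷ)

    ℓ N T a : ℕ
    ℓ = suc ℓ₁
    N = suc b₁ + suc b₁ + e
    T = 2 * w
    a = ℓ * u * T

    -- The target density (ℓ - 1) / ℓ + c is A / (ℓ v), and α is the bound of `independent-≤`.
    A α : ℕ
    A = ℓ₁ * v + u * ℓ
    α = ℓ * (N * h) + suc e * M

    uK≡ : u * K ≡ 2 * a * v * M
    uK≡ = trans (cong (λ N → u * (ℓ * (N * M))) N≡) (r u ℓ v (2 * w) M)
      where
      r : ∀ u ℓ v T M → u * (ℓ * (2 * (v * T) * M)) ≡ 2 * (ℓ * u * T) * v * M
      r = solve-∀

    -- By the choice of M, light clusters fill at most ℓNh = M / 2. Hence α = (e + 2) M - M / 2 = cK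
    -- - M / 2, as e + 2 = cℓN and K = ℓNM.
    independence-gap : 2 * v * α + v * M ≡ 2 * u * K
    independence-gap = begin
      2 * v * α + v * M                                ≡⟨ r ℓ N h v e M ⟩
      v * (2 * (ℓ * N) * h + (2 * suc e + 1) * M)      ≡⟨ cong (λ z → v * (z + (2 * suc e + 1) * M)) (sym M≡) ⟩
      v * (M + (2 * suc e + 1) * M)                    ≡⟨ r′ v e M ⟩
      2 * (suc e + 1) * v * M              ≡⟨ cong (λ z → 2 * z * v * M) e+2≡ ⟩
      2 * (2 * a) * v * M                  ≡⟨ r″ a v M ⟩
      2 * (2 * a * v * M)                  ≡⟨ cong (2 *_) (sym uK≡) ⟩
      2 * (u * K)                          ≡⟨ sym (*-assoc 2 u K) ⟩
      2 * u * K ∎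
      where
      open ≡-Reasoning
      r : ∀ ℓ N h v e M → 2 * v * (ℓ * (N * h) + (1 + e) * M) + v * M ≡ v * (2 * (ℓ * N) * h + (2 * (1 + e) + 1) * M)
      r = solve-∀
      r′ : ∀ v e M → v * (M + (2 * (1 + e) + 1) * M) ≡ 2 * (1 + e + 1) * v * M
      r′ = solve-∀
      r″ : ∀ a v M → 2 * (2 * a) * v * M ≡ 2 * (2 * a * v * M)
      r″ = solve-∀

    P : ℕ
    P = sum (λ x → sum (purpleᴷ x))

    -- The dropped purple pairs cost a vertex no more than one cluster, because M = 2ℓNh absorbs one
    -- loss of h per cluster.
    blocked-≤ : degree * B ≤ M
    blocked-≤ = begin
      degree * B       ≤⟨ *-mono-≤ degree≤ B≤h ⟩
      ℓ * N * h        ≤⟨ *-monoˡ-≤ h (m≤n*m (ℓ * N) 2) ⟩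
      2 * (ℓ * N) * h  ≡⟨ sym M≡ ⟩
      M ∎
      where
      open ≤-Reasoning
      degree≤ : degree ≤ ℓ * N
      degree≤ = +-monoˡ-≤ (ℓ₁ * N) (s≤s (m≤n+m e _))

    -- A vertex loses at most 2M: one cluster because `degree` has e + 1 in place of e + 2 = cℓN,
    -- and one for dropped pairs. The factor T in N makes K = 4ℓvwM, so the loss is a proportion 1 /
    -- (2ℓvw) of K.
    purple-density : 2 * w * A * (K * K) ≤ 2 * w * (ℓ * v) * P + K * K
    purple-density = begin
      T * A * (K * K)                                ≡⟨ trans (r₀ T A K) (cong (λ z → T * z * K) AK≡) ⟩
      T * (ℓ * v * M * (2 * a + ℓ₁ * N)) * K         ≡⟨ r₁ T (ℓ * v) M (2 * a + ℓ₁ * N) K ⟩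
      T * (ℓ * v) * (K * ((2 * a + ℓ₁ * N) * M))     ≤⟨ *-monoʳ-≤ (T * (ℓ * v)) per-vertex ⟩
      T * (ℓ * v) * (P + K * M + K * M)              ≡⟨ r₂ T (ℓ * v) P K M ⟩
      T * (ℓ * v) * P + 2 * (T * (ℓ * v)) * M * K    ≡⟨ cong (λ z → T * (ℓ * v) * P + z * K) (sym K≡) ⟩
      T * (ℓ * v) * P + K * K ∎
      where
      open ≤-Reasoning
      K≡ : K ≡ 2 * (T * (ℓ * v)) * M
      K≡ = trans (cong (λ N → ℓ * (N * M)) N≡) (r ℓ v T M)
        where
        r : ∀ ℓ v T M → ℓ * (2 * (v * T) * M) ≡ 2 * (T * (ℓ * v)) * M
        r = solve-∀
      AK≡ : A * K ≡ ℓ * v * M * (2 * a + ℓ₁ * N)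
      AK≡ = trans (r ℓ₁ v u ℓ K) (trans (cong (λ z → ℓ₁ * v * K + ℓ * z) uK≡) (r′ ℓ₁ v ℓ N M a))
        where
        r : ∀ ℓ₁ v u ℓ K → (ℓ₁ * v + u * ℓ) * K ≡ ℓ₁ * v * K + ℓ * (u * K)
        r = solve-∀
        r′ : ∀ ℓ₁ v ℓ N M a → ℓ₁ * v * (ℓ * (N * M)) + ℓ * (2 * a * v * M) ≡ ℓ * v * M * (2 * a + ℓ₁ * N)
        r′ = solve-∀
      per-vertex : K * ((2 * a + ℓ₁ * N) * M) ≤ P + K * M + K * M
      per-vertex = begin
        K * ((2 * a + ℓ₁ * N) * M)              ≡⟨ cong (λ z → K * ((z + ℓ₁ * N) * M)) (sym e+2≡) ⟩
        K * ((suc e + 1 + ℓ₁ * N) * M)          ≡⟨ r K e (ℓ₁ * N) M ⟩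
        K * (degree * M) + K * M                ≤⟨ +-monoˡ-≤ (K * M) purple-total ⟩
        P + K * (degree * B) + K * M            ≤⟨ +-monoˡ-≤ (K * M) (+-monoʳ-≤ P (*-monoʳ-≤ K blocked-≤)) ⟩
        P + K * M + K * M ∎
        where
        r : ∀ K e x M → K * ((1 + e + 1 + x) * M) ≡ K * ((1 + e + x) * M) + K * M
        r = solve-∀
      r₀ : ∀ T A K → T * A * (K * K) ≡ T * (A * K) * K
      r₀ = solve-∀
      r₁ : ∀ T s M y K → T * (s * M * y) * K ≡ T * s * (K * (y * M))
      r₁ = solve-∀
      r₂ : ∀ T s P K M → T * s * (P + K * M + K * M) ≡ T * s * P + 2 * (T * s) * M * K
      r₂ = solve-∀

    -- The first summand controls the rounding in `blow-up-count`; the second gives n / K ≥ 2uK for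
    -- `clique-too-large`.
    threshold : ℕ
    threshold = 4 * w * A * K + 2 * u * K * K

    module _ (n : ℕ) (threshold≤n : threshold ≤ n) where

      open Blowup ℓ₁ b₁ e M h B e≤b₁ L n public using (col; col-symmetric; redOrPurple-free)
      open Blowup ℓ₁ b₁ e M h B e≤b₁ L n using (blueOrPurple-clique-≤; purpleCount-≥; n≤)

      private
        q = n / K
        2uK≤q : 2 * u * K ≤ q
        2uK≤q = ≤-trans (≤-reflexive (sym (m*n/n≡m (2 * u * K) K))) (/-monoˡ-≤ K (≤-trans (m≤n+m _ _) threshold≤n))

      blueOrPurple-free : ∀ t → u * n ≤ t * v → KFree t (BlueOrPurple col)
      blueOrPurple-free t un≤tv clique = clique-too-large u v t n q K M α
        (*-mono-≤ 1≤v (>-nonZero⁻¹ M)) (m/n*n≤m n K) 2uK≤q independence-gap (blueOrPurple-clique-≤ clique) un≤tv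

      purple-bound : w * A * (n * n) ≤ 2 * (ℓ * v) * w * purpleCount col + ℓ * v * (n * n)
      purple-bound = blow-up-count w A (ℓ * v) P (purpleCount col) n q K (*-mono-≤ {1} {ℓ} (s≤s z≤n) 1≤v)
        (m/n*n≤m n K) n≤ (≤-trans (m≤m+n _ _) threshold≤n) purple-density purpleCount-≥

  -- Here c = u / v and ε ≥ 1 / w; the density bound is multiplied by 2ℓvw.
  DenseColourings : (ℓ₁ u v w : ℕ) → Set
  DenseColourings ℓ₁ u v w = Σ ℕ λ n₀ → (n : ℕ) → n₀ ≤ n → Σ (Colouring n) λ col →
    IsSymmetric col
    × KFree (suc (2 * suc ℓ₁)) (RedOrPurple col)
    × (∀ t → u * n ≤ t * v → KFree t (BlueOrPurple col))
    × w * (ℓ₁ * v + u * suc ℓ₁) * (n * n) ≤ 2 * (suc ℓ₁ * v) * w * purpleCount col + suc ℓ₁ * v * (n * n)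

  denseColourings : ∀ ℓ₁ u v w → 1 ≤ u → 1 ≤ w → 3 * suc ℓ₁ * u < v → DenseColourings ℓ₁ u v w
  -- The ratio M / h = 2ℓN leaves half a cluster of room for all light clusters together.
  denseColourings ℓ₁ u v w 1≤u 1≤w 3ℓu<v = assemble (labelGraph (2 * (ℓ * N)))
    where
    ℓ  = suc ℓ₁
    T  = 2 * w
    -- Half of cℓN for N = 2vT. Then e = 2 (a - 1) gives e + 2 = cℓN, and `b₁` is what completes the
    -- circumference.
    a  = ℓ * u * T
    a₁ = pred a
    b₁ = v * T ∸ a
    e  = a₁ + a₁
    N  = suc b₁ + suc b₁ + e

    1≤v : 1 ≤ v
    1≤v = ≤-trans (s≤s z≤n) 3ℓu<v

    suc-a₁ : suc a₁ ≡ a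
    suc-a₁ = suc-pred a {{>-nonZero (*-mono-≤ (*-mono-≤ {1} {ℓ} (s≤s z≤n) 1≤u) (*-mono-≤ {1} {2} (s≤s z≤n) 1≤w))}}

    -- Here c < 1 / (3ℓ) enters: it leaves b₁ = vT - a ≥ 2a ≥ e.
    3a≤vT : a + (a + a) ≤ v * T
    3a≤vT = ≤-trans (≤-reflexive (r ℓ u T)) (*-monoˡ-≤ T (<⇒≤ 3ℓu<v))
      where
      r : ∀ ℓ u T → ℓ * u * T + (ℓ * u * T + ℓ * u * T) ≡ 3 * ℓ * u * T
      r = solve-∀

    a+b₁ : a + b₁ ≡ v * T
    a+b₁ = m+[n∸m]≡n (≤-trans (m≤m+n a _) 3a≤vT)

    e≤b₁ : e ≤ b₁
    e≤b₁ = ≤-trans (+-mono-≤ (pred[n]≤n {a}) (pred[n]≤n {a})) (+-cancelˡ-≤ a _ _ (≤-trans 3a≤vT (≤-reflexive (sym a+b₁))))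

    N≡ : N ≡ 2 * (v * T)
    N≡ = trans (r a₁ b₁) (cong (2 *_) (trans (cong (_+ b₁) suc-a₁) a+b₁))
      where
      r : ∀ a₁ b₁ → (1 + b₁) + (1 + b₁) + (a₁ + a₁) ≡ 2 * ((1 + a₁) + b₁)
      r = solve-∀

    e+2≡ : suc e + 1 ≡ 2 * a
    e+2≡ = trans (r a₁) (cong (2 *_) suc-a₁)
      where
      r : ∀ a₁ → 1 + (a₁ + a₁) + 1 ≡ 2 * (1 + a₁)
      r = solve-∀

    assemble : (∃₂ λ h B → B ≤ h × 1 ≤ h × LabelGraph (2 * (ℓ * N) * h) h B) → DenseColourings ℓ₁ u v w
    assemble (h , B , B≤h , 1≤h , L) = threshold , λ n large →
      col n large , col-symmetric n large , redOrPurple-free n large , blueOrPurple-free n large , purple-bound n large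
      where
      open Density ℓ₁ u v w b₁ e (2 * (ℓ * N) * h) h B e≤b₁ L {{m*n≢0 (2 * (ℓ * N)) h {{_}} {{>-nonZero 1≤h}}}} N≡ e+2≡ refl B≤h 1≤v

-- Translation to rational numbers

open Colourings using (DenseColourings; denseColourings)

open import Defs
open import Data.Nat using (ℕ; suc; _≤_; _*_; _∸_; NonZero)
open import Data.Integer using (+_; ∣_∣)
open import Data.Rational using (ℚ; _/_; _+_; _-_; 0ℚ; 1ℚ; _<_; ceiling) renaming (_*_ to _*ℚ_; _≤_ to _≤ℚ_)
open import Data.Product using (Σ; _×_)

open import Data.Nat as ℕ using (zero; z≤n; s≤s)
import Data.Nat.Properties as ℕ
open import Data.Nat.Coprimality using (Coprime)
open import Data.Nat.Tactic.RingSolver using () renaming (solve-∀ to ℕsolve-∀)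
open import Data.Integer as ℤ using (-[1+_]; +≤+; +<+)
import Data.Integer.Properties as ℤ
import Data.Integer.DivMod as ℤ
open import Data.Integer.Tactic.RingSolver using (solve-∀)
open import Data.Rational as ℚ using (mkℚ; *<*; toℚᵘ; ↥_; ↧_)
import Data.Rational.Properties as ℚ
open import Data.Rational.Unnormalised as ℚᵘ using (ℚᵘ; mkℚᵘ; *≤*)
import Data.Rational.Unnormalised.Properties as ℚᵘ
open import Data.Product using (_,_)
open import Relation.Binary.PropositionalEquality

toℚᵘ-/ : ∀ n d → toℚᵘ (n / suc d) ℚᵘ.≃ mkℚᵘ n d
toℚᵘ-/ n d = ℚ.toℚᵘ-fromℚᵘ (mkℚᵘ n d)

-- The ceiling is the negated floor of -p, so the division inequality for -p is negated.
≤⌈⌉ : ∀ p → ↥ p ℤ.≤ ⌈ p ⌉ ℤ.* ↧ p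
≤⌈⌉ p@record{} = subst₂ ℤ._≤_ (trans (cong ℤ.-_ (ℚ.↥-neg p)) (ℤ.neg-involutive (↥ p)))
  (trans (ℤ.neg-distribˡ-* (ℚ.floor (ℚ.- p)) (↧ (ℚ.- p))) (cong (⌈ p ⌉ ℤ.*_) (ℚ.↧-neg p)))
  (ℤ.neg-mono-≤ (floor-≤ (ℚ.- p)))
  where
  floor-≤ : ∀ q → ℚ.floor q ℤ.* ↧ q ℤ.≤ ↥ q
  floor-≤ q@record{} = ℤ.[n/d]*d≤n (↥ q) (↧ q)

i≤+∣i∣ : ∀ i → i ℤ.≤ + ∣ i ∣
i≤+∣i∣ (+ n)    = ℤ.≤-refl
i≤+∣i∣ -[1+ n ] = ℤ.-≤+

module _ (u v-1 : ℕ) .(cop : Coprime u (suc v-1)) where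

  private
    c : ℚ
    c = mkℚ (+ u) v-1 cop
    v : ℕ
    v = suc v-1

  toℚᵘ-c* : ∀ m → toℚᵘ (c *ℚ (+ m / 1)) ℚᵘ.≃ mkℚᵘ (+ u) v-1 ℚᵘ.* mkℚᵘ (+ m) 0
  toℚᵘ-c* m = ℚᵘ.≃-trans (ℚ.toℚᵘ-homo-* c (+ m / 1)) (ℚᵘ.*-congˡ {mkℚᵘ (+ u) v-1} (toℚᵘ-/ (+ m) 0))

  c*m<1⇒ : ∀ m → c *ℚ (+ m / 1) < 1ℚ → m * u ℕ.< v
  c*m<1⇒ m lt with ℚᵘ.<-respˡ-≃ (toℚᵘ-c* m) (ℚ.toℚᵘ-mono-< lt)
  ... | ℚᵘ.*<* lt′ = subst₂ ℕ._<_ (ℕ.*-comm u m) (trans (ℕ.+-identityʳ (v * 1)) (ℕ.*-identityʳ v))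
    (ℤ.drop‿+<+ (subst (ℤ._< _) (trans (ℤ.*-identityʳ (+ u ℤ.* + m)) (sym (ℤ.pos-* u m))) lt′))

  -- `p` stands for cn; as a variable it can be matched, which exposes its numerator and
  -- denominator.
  ⌈⌉-bound : ∀ p n → toℚᵘ p ℚᵘ.≃ mkℚᵘ (+ u) v-1 ℚᵘ.* mkℚᵘ (+ n) 0 → u * n ≤ ∣ ⌈ p ⌉ ∣ * v
  ⌈⌉-bound p@record{} n p≃ with ℚᵘ.≤-respˡ-≃ p≃ below
    where
    below : toℚᵘ p ℚᵘ.≤ mkℚᵘ (+ ∣ ⌈ p ⌉ ∣) 0
    below = *≤* (ℤ.≤-trans (ℤ.≤-reflexive (ℤ.*-identityʳ (↥ p)))
      (ℤ.≤-trans (≤⌈⌉ p) (ℤ.*-monoʳ-≤-nonNeg (↧ p) (i≤+∣i∣ ⌈ p ⌉))))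
  ... | *≤* le = ℤ.drop‿+≤+ (subst₂ ℤ._≤_ (trans (ℤ.*-identityʳ (+ u ℤ.* + n)) (sym (ℤ.pos-* u n)))
    (trans (sym (ℤ.pos-* ∣ ⌈ p ⌉ ∣ (v * 1))) (cong (λ z → + (∣ ⌈ p ⌉ ∣ * z)) (ℕ.*-identityʳ v))) le)

  ⌈cn⌉-bound : ∀ n → u * n ≤ ∣ ⌈ c *ℚ (+ n / 1) ⌉ ∣ * v
  ⌈cn⌉-bound n = ⌈⌉-bound (c *ℚ (+ n / 1)) n (toℚᵘ-c* n)

  -- Since ε = (x + 1) / (y + 1) is at least 1 / w with w = y + 1, the integral error term, which
  -- corresponds to 1 / w, is within the one for ε.
  density-ineq : ∀ ℓ₁ x y .(cop′ : Coprime (suc x) (suc y)) nn pc →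
    suc y * (ℓ₁ * v ℕ.+ u * suc ℓ₁) * nn ≤ 2 * (suc ℓ₁ * v) * suc y * pc ℕ.+ suc ℓ₁ * v * nn →
    (((+ ℓ₁ / suc ℓ₁) + c) - mkℚ (+ suc x) y cop′) *ℚ (+ nn / 2) ≤ℚ (+ pc / 1)
  density-ineq ℓ₁ x y cop′ nn pc le = ℚ.toℚᵘ-cancel-≤ (ℚᵘ.≤-respˡ-≃ (ℚᵘ.≃-sym lhs) (ℚᵘ.≤-respʳ-≃ (ℚᵘ.≃-sym (toℚᵘ-/ (+ pc) 0)) (*≤* ineq)))
    where
    ε : ℚ
    ε = mkℚ (+ suc x) y cop′
    L C E H : ℚᵘ
    L = mkℚᵘ (+ ℓ₁) ℓ₁
    C = mkℚᵘ (+ u) v-1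
    E = mkℚᵘ (-[1+ x ]) y
    H = mkℚᵘ (+ nn) 1
    lhs : toℚᵘ ((((+ ℓ₁ / suc ℓ₁) + c) - ε) *ℚ (+ nn / 2)) ℚᵘ.≃ (L ℚᵘ.+ C ℚᵘ.+ E) ℚᵘ.* H
    lhs = ℚᵘ.≃-trans (ℚ.toℚᵘ-homo-* (((+ ℓ₁ / suc ℓ₁) + c) - ε) (+ nn / 2)) (ℚᵘ.*-cong
      (ℚᵘ.≃-trans (ℚ.toℚᵘ-homo-+ ((+ ℓ₁ / suc ℓ₁) + c) (ℚ.- ε)) (ℚᵘ.+-congˡ E
        (ℚᵘ.≃-trans (ℚ.toℚᵘ-homo-+ (+ ℓ₁ / suc ℓ₁) c) (ℚᵘ.+-congˡ C (toℚᵘ-/ (+ ℓ₁) ℓ₁)))))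
      (toℚᵘ-/ (+ nn) 1))
    ineq : ((+ ℓ₁ ℤ.* + v ℤ.+ + u ℤ.* + suc ℓ₁) ℤ.* + suc y ℤ.+ -[1+ x ] ℤ.* + (suc ℓ₁ * v)) ℤ.* + nn ℤ.* + 1
           ℤ.≤ + pc ℤ.* + (suc ℓ₁ * v * suc y * 2)
    ineq = begin
      (Aᶻ ℤ.* + w ℤ.+ -[1+ x ] ℤ.* + s) ℤ.* + nn ℤ.* + 1        ≡⟨ r₁ Aᶻ (+ w) (+ suc x) (+ s) (+ nn) ⟩
      + w ℤ.* Aᶻ ℤ.* + nn ℤ.- + suc x ℤ.* + s ℤ.* + nn           ≡⟨ cong₂ ℤ._-_ wA (pos-*³ (suc x) s nn) ⟩
      + (w * A * nn) ℤ.- + (suc x * s * nn)                       ≤⟨ ℤ.+-monoˡ-≤ (ℤ.- + (suc x * s * nn)) (+≤+ (ℕ.≤-trans le (ℕ.+-monoʳ-≤ (2 * s * w * pc) (ℕ.*-monoˡ-≤ nn (ℕ.m≤m+n s _))))) ⟩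
      + (2 * s * w * pc ℕ.+ suc x * s * nn) ℤ.- + (suc x * s * nn) ≡⟨ cong (ℤ._- + (suc x * s * nn)) (ℤ.pos-+ (2 * s * w * pc) (suc x * s * nn)) ⟩
      + (2 * s * w * pc) ℤ.+ + (suc x * s * nn) ℤ.- + (suc x * s * nn) ≡⟨ r₂ (+ (2 * s * w * pc)) (+ (suc x * s * nn)) ⟩
      + (2 * s * w * pc)                                           ≡⟨ cong +_ (r₃ s w pc) ⟩
      + (pc * (s * w * 2))                                         ≡⟨ ℤ.pos-* pc (s * w * 2) ⟩
      + pc ℤ.* + (s * w * 2) ∎
      where
      open ℤ.≤-Reasoning
      w = suc y
      s = suc ℓ₁ * v
      A = ℓ₁ * v ℕ.+ u * suc ℓ₁
      Aᶻ = + ℓ₁ ℤ.* + v ℤ.+ + u ℤ.* + suc ℓ₁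
      A≡ : Aᶻ ≡ + A
      A≡ = sym (trans (ℤ.pos-+ (ℓ₁ * v) (u * suc ℓ₁)) (cong₂ ℤ._+_ (ℤ.pos-* ℓ₁ v) (ℤ.pos-* u (suc ℓ₁))))
      pos-*³ : ∀ a b c → + a ℤ.* + b ℤ.* + c ≡ + (a * b * c)
      pos-*³ a b c = sym (trans (ℤ.pos-* (a * b) c) (cong (ℤ._* + c) (ℤ.pos-* a b)))
      wA : + w ℤ.* Aᶻ ℤ.* + nn ≡ + (w * A * nn)
      wA = trans (cong (λ z → + w ℤ.* z ℤ.* + nn) A≡) (pos-*³ w A nn)
      r₁ : ∀ A w X s n → (A ℤ.* w ℤ.+ (ℤ.- X) ℤ.* s) ℤ.* n ℤ.* + 1 ≡ w ℤ.* A ℤ.* n ℤ.- X ℤ.* s ℤ.* n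
      r₁ = solve-∀
      r₂ : ∀ i j → i ℤ.+ j ℤ.- j ≡ i
      r₂ = solve-∀
      r₃ : ∀ s w p → 2 * s * w * p ≡ p * (s * w * 2)
      r₃ = ℕsolve-∀

  translate : ∀ ℓ₁ x y .(cop′ : Coprime (suc x) (suc y)) → DenseColourings ℓ₁ u v (suc y) →
    Σ ℕ λ N → (n : ℕ) → N ≤ n → Σ (Colouring n) λ col →
      IsSymmetric col
      × KFree (suc (2 * suc ℓ₁)) (RedOrPurple col)
      × KFree ∣ ⌈ c *ℚ (+ n / 1) ⌉ ∣ (BlueOrPurple col)
      × ((((+ ℓ₁ / suc ℓ₁) + c) - mkℚ (+ suc x) y cop′) *ℚ (+ (n * n) / 2) ≤ℚ (+ purpleCount col / 1))
  translate ℓ₁ x y cop′ (N , colouring) = N , λ n N≤n →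
    let col , symmetric , rp-free , bp-free , dense = colouring n N≤n in
    col , symmetric , rp-free , bp-free _ (⌈cn⌉-bound n) , density-ineq ℓ₁ x y cop′ (n * n) (purpleCount col) dense

theorem5p1 : (ℓ : ℕ) → .{{_ : NonZero ℓ}} → (c : ℚ) → 0ℚ < c → c *ℚ (+ (3 * ℓ) / 1) < 1ℚ →
    (ε : ℚ) → 0ℚ < ε →
    Σ ℕ λ N → (n : ℕ) → N ≤ n →
    Σ (Colouring n) λ col →
    IsSymmetric col
    × KFree (suc (2 * ℓ)) (RedOrPurple col)
    × KFree ∣ ⌈ c *ℚ (+ n / 1) ⌉ ∣ (BlueOrPurple col)
    × ((((+ (ℓ ∸ 1) / ℓ) + c) - ε) *ℚ (+ (n * n) / 2) ≤ℚ (+ purpleCount col / 1))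
theorem5p1 (suc ℓ₁) (mkℚ (+ suc u-1) v-1 cop) 0<c c<1 (mkℚ (+ suc x) y cop′) 0<ε =
  translate (suc u-1) v-1 cop ℓ₁ x y cop′
    (denseColourings ℓ₁ (suc u-1) (suc v-1) (suc y) (s≤s z≤n) (s≤s z≤n) (c*m<1⇒ (suc u-1) v-1 cop (3 * suc ℓ₁) c<1))
theorem5p1 (suc ℓ₁) (mkℚ (+ zero) v-1 cop) (*<* (+<+ ()))
theorem5p1 (suc ℓ₁) (mkℚ -[1+ _ ] v-1 cop) (*<* ())
theorem5p1 (suc ℓ₁) (mkℚ (+ suc _) v-1 cop) 0<c c<1 (mkℚ (+ zero) y cop′) (*<* (+<+ ()))
theorem5p1 (suc ℓ₁) (mkℚ (+ suc _) v-1 cop) 0<c c<1 (mkℚ -[1+ _ ] y cop′) (*<* ())
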